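{- Let $k$ be a fixed (positive) integer. The function mapping $(1^n)\mapsto\#\mathrm{Av}_n(12\ldots k)$ is in $\#\mathsf{L}$.
   Context: For $\sigma\in S_k$, $\mathrm{Av}_n(\sigma)$ is the set of permutations $w\in S_n$ avoiding the pattern $\sigma$: there are no indices $i_1<i_2<\cdots<i_k$ such that for all $1\le j<l\le k$ one has $w_{i_j}<w_{i_l}\Leftrightarrow\sigma_j<\sigma_l$. Thus $\mathrm{Av}_n(12\ldots k)$ is the set of permutations in $S_n$ whose longest increasing subsequence has length at most $k-1$. The alphabet is $\Sigma=\{0,1\}$; $1^n$ is the string of $n$ ones. A function given only on strings of a displayed form is extended by $0$ to all other strings. $\#\mathsf{L}$ is the class of functions $f:\Sigma^*\to\mathbb{N}_0$ such that $f(x)$ is the number of accepting computation paths on input $x$ of a fixed nondeterministic Turing machine with read-only input tape that uses $O(\log|x|)$ work space and halts on every computation path. Equivalently: there are a polynomial $q$ and a deterministic $O(\log|x|)$-space Turing machine $M$ with an additional read-once, left-to-right witness tape such that $f(x)=\#\{w\in\Sigma^{q(|x|)}\mid M(x,w)=\mathsf{yes}\}$. -}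

module Defs where

open import Data.Bool.Base using (Bool; true; T; if_then_else_)
import Data.Bool.Properties as Bool
open import Data.Fin.Base as Fin using (Fin; zero; suc; inject₁)
import Data.Fin.Properties as Fin
open import Data.List.Base as List
  using (List; []; _∷_; length; replicate; filter; cartesianProductWith)
import Data.List.Properties as List
open import Data.List.Membership.Propositional using (_∈_)
open import Data.List.Relation.Unary.Unique.Propositional using (Unique)
open import Data.Nat.Base using (ℕ; zero; suc; _+_; _*_; _≤_)
open import Data.Nat.Logarithm using (⌊log₂_⌋)
open import Data.Product.Base using (∃; _×_; _,_; uncurry; ∃-syntax; Σ-syntax)
open import Data.Vec.Base as Vec using (Vec; []; _∷_; lookup; zipWith)
open import Data.Vec.Relation.Unary.AllPairs using (allPairs?)
open import Data.Vec.Relation.Unary.Linked using (Linked; linked?)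
import Data.Vec.Relation.Unary.Unique.Propositional as Vec
open import Function.Base using (flip)
open import Function.Bundles using (_⇔_; mk⇔; _↔_; module Equivalence)
open import Induction.WellFounded using (Acc)
open import Level using (Level; 0ℓ)
open import Relation.Binary.Construct.Closure.ReflexiveTransitive using (Star)
open import Relation.Binary.PropositionalEquality.Core using (_≡_)
open import Relation.Nullary.Decidable
  using (Dec; does; map′; ¬?; _×-dec_; _→-dec_)
open import Relation.Nullary.Negation using (¬_)
open import Relation.Unary using (Pred; Decidable)

private
  variable
    ℓ : Level
    A B : Set ℓ
    k n m : ℕ

------------------------------------------------------------------------
-- Pattern avoidance

-- Permutations are written in one-line notation: w ∈ Sₙ is a word
-- w₁…wₙ over Fin n (values 0,…,n-1 instead of 1,…,n) with distinct letters.
-- The index tuple i₁ < … < iₖ of an occurrence is the vector i.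

IsOccurrence : Vec (Fin k) k → Vec (Fin n) n → Pred (Vec (Fin n) k) 0ℓ
IsOccurrence σ w i =
  Linked Fin._<_ i ×
  (∀ j l → j Fin.< l →
    (lookup w (lookup i j) Fin.< lookup w (lookup i l)) ⇔
    (lookup σ j Fin.< lookup σ l))

Av : (n : ℕ) → Vec (Fin k) k → Pred (Vec (Fin n) n) 0ℓ
Av n σ w = Vec.Unique w × ¬ (∃[ i ] IsOccurrence σ w i)

_⇔-dec_ : Dec A → Dec B → Dec (A ⇔ B)
a? ⇔-dec b? = map′ (uncurry mk⇔) (λ e → Equivalence.to e , Equivalence.from e)
                   ((a? →-dec b?) ×-dec (b? →-dec a?))

anyVec? : ∀ k {P : Pred (Vec (Fin n) k) ℓ} → Decidable P → Dec (∃ P)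
anyVec? zero    P? = map′ (λ p → [] , p) (λ { ([] , p) → p }) (P? [])
anyVec? (suc k) P? =
  map′ (λ { (a , v , p) → a ∷ v , p }) (λ { (a ∷ v , p) → a , v , p })
       (Fin.any? λ a → anyVec? k λ v → P? (a ∷ v))

isOccurrence? : (σ : Vec (Fin k) k) (w : Vec (Fin n) n) → Decidable (IsOccurrence σ w)
isOccurrence? σ w i =
  linked? Fin._<?_ i ×-dec
  (Fin.all? λ j → Fin.all? λ l → (j Fin.<? l) →-dec
    ((lookup w (lookup i j) Fin.<? lookup w (lookup i l)) ⇔-dec
     (lookup σ j Fin.<? lookup σ l)))

Av? : (n : ℕ) (σ : Vec (Fin k) k) → Decidable (Av n σ)
Av? {k} n σ w =
  allPairs? (λ a b → ¬? (a Fin.≟ b)) w ×-dec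
  ¬? (anyVec? k (isOccurrence? σ w))

-- Every word of length m over Fin n, each listed exactly once.
words : (n m : ℕ) → List (Vec (Fin n) m)
words n zero    = [] ∷ []
words n (suc m) = cartesianProductWith _∷_ (List.allFin n) (words n m)

#Av : (n : ℕ) → Vec (Fin k) k → ℕ
#Av n σ = length (filter (Av? n σ) (words n n))

increasing : (k : ℕ) → Vec (Fin k) k
increasing = Vec.allFin

------------------------------------------------------------------------
-- Functions on strings; the letter 1 is true

ones : ℕ → List Bool
ones n = replicate n true

-- The function 1ⁿ ↦ g n, extended by 0 to all other strings.
onOnes : (ℕ → ℕ) → List Bool → ℕ
onOnes g x = if does (List.≡-dec Bool._≟_ x (ones (length x))) then g (length x) else 0

------------------------------------------------------------------------
-- Tapes

data Move : Set where
  left stay right : Move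

data InputSymbol : Set where
  ⊢ ⊣ : InputSymbol
  bit : Bool → InputSymbol

-- The input x is written between end markers, ⊢ x₁ … xₙ ⊣; the head position
-- is an element of Fin (2 + n).
readInput : (x : List Bool) → Fin (2 + length x) → InputSymbol
readInput x zero    = ⊢
readInput x (suc p) = go x p
  where
  go : (y : List Bool) → Fin (1 + length y) → InputSymbol
  go []      _       = ⊣
  go (b ∷ y) zero    = bit b
  go (b ∷ y) (suc p) = go y p

-- The input head does not leave the end markers.
moveHead : Move → Fin (suc n) → Fin (suc n)
moveHead             left  zero    = zero
moveHead             left  (suc p) = inject₁ p
moveHead             stay  p       = p
moveHead {n = zero}  right p       = p
moveHead {n = suc n} right zero    = suc zero
moveHead {n = suc n} right (suc p) = suc (moveHead right p)

-- A two-way infinite tape, of which exactly the cells visited so far are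
-- stored; the cells on either side are listed starting next to the head.
record Tape (Γ : Set) : Set where
  constructor tape
  field
    before  : List Γ
    current : Γ
    after   : List Γ

  visited : ℕ
  visited = length before + 1 + length after

-- Overwrite the scanned cell, then move; cells visited for the first time
-- contain the blank.
writeMove : {Γ : Set} → (blank : Γ) → Γ × Move → Tape Γ → Tape Γ
writeMove blank (b , left)  (tape []       _ rs)       = tape [] blank (b ∷ rs)
writeMove blank (b , left)  (tape (a ∷ ls) _ rs)       = tape ls a (b ∷ rs)
writeMove blank (b , stay)  (tape ls       _ rs)       = tape ls b rs
writeMove blank (b , right) (tape ls       _ [])       = tape (b ∷ ls) blank []
writeMove blank (b , right) (tape ls       _ (a ∷ rs)) = tape (b ∷ ls) a rs

------------------------------------------------------------------------
-- Nondeterministic Turing machines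

record Action (Q Γ : Set) (t : ℕ) : Set where
  constructor action
  field
    nextState : Q
    inputMove : Move
    workMoves : Vec (Γ × Move) t

-- The list δ q a bs is the set of actions available in state q when a is
-- scanned on the input tape and bs on the work tapes; as it is
-- duplicate-free, no action is counted twice.
record NTM : Set₁ where
  field
    workTapes       : ℕ
    Q               : Set
    Γ               : Set
    Q-finite        : ∃[ s ] (Q ↔ Fin s)
    Γ-finite        : ∃[ s ] (Γ ↔ Fin s)
    start           : Q
    accepting       : Q → Bool
    blank           : Γ
    δ               : Q → InputSymbol → Vec Γ workTapes → List (Action Q Γ workTapes)
    δ-unique        : ∀ q a bs → Unique (δ q a bs)

module Computation (M : NTM) (x : List Bool) where
  open NTM M

  record Config : Set where
    constructor config
    field
      state : Q
      head  : Fin (2 + length x)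
      tapes : Vec (Tape Γ) workTapes
  open Config

  initial : Config
  initial = config start zero (Vec.replicate workTapes (tape [] blank []))

  enabled : Config → List (Action Q Γ workTapes)
  enabled c = δ (state c) (readInput x (head c)) (Vec.map Tape.current (tapes c))

  perform : Action Q Γ workTapes → Config → Config
  perform (action q d ws) c =
    config q (moveHead d (head c)) (zipWith (writeMove blank) ws (tapes c))

  data _⟶_ (c : Config) : Config → Set where
    step : ∀ {a} → a ∈ enabled c → c ⟶ perform a c

  _⟶*_ : Config → Config → Set
  _⟶*_ = Star _⟶_

  Accepts : Pred Config 0ℓ
  Accepts c = enabled c ≡ [] × T (accepting (state c))

  -- Paths are sequences of transitions from the initial configuration to a
  -- halting one.
  AcceptingPath : Set
  AcceptingPath = Σ[ c ∈ Config ] (initial ⟶* c) × Accepts c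

  -- No computation path is infinite.
  Halts : Set
  Halts = Acc (flip _⟶_) initial

  space : Config → ℕ
  space c = Vec.sum (Vec.map Tape.visited (tapes c))

HaltsOnAllPaths : NTM → Set
HaltsOnAllPaths M = ∀ x → Computation.Halts M x

LogSpace : NTM → Set
LogSpace M = ∃[ C ] ∃[ n₀ ] ∀ x → n₀ ≤ length x →
  let open Computation M x in
  ∀ c → initial ⟶* c → space c ≤ C * ⌊log₂ length x ⌋

#L : (List Bool → ℕ) → Set₁
#L f = Σ[ M ∈ NTM ]
  HaltsOnAllPaths M × LogSpace M × (∀ x → Fin (f x) ↔ Computation.AcceptingPath M x)

module Submission where

-- The permutations of n letters without an increasing subsequence of length m + 1 correspond
-- bijectively to the closed walks of length 2n at the empty shape in the Young graph of shapes
-- with at most m rows: n additions of a box followed by n removals. Such a shape is a tuple of m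
-- counters that do not exceed n, so a nondeterministic machine can guess the walk box by box in
-- logarithmic space, and its accepting computation paths are the closed walks.
--
-- The bijection is a Robinson-Schensted correspondence in the form of Fomin's growth diagrams. For
-- shapes μ and ν, the pairs of edges ρ → μ, ρ → ν, together with one further element if μ = ν has
-- fewer than m rows, are matched with the pairs of edges μ → κ, ν → κ (closeSquare, openSquare).
-- Applied along a chain of shapes, this local rule inserts a letter (insert, remove); applied to
-- all letters of a word, it gives a pair of chains (rsk, unrsk). The rule is chosen so that the
-- further element opens a new row, while in all other cases κ has as many rows as the longer one of
-- μ and ν. So the numbers of rows obey the recursion for the lengths of longest increasing
-- subsequences (rowsFrom-insert, rsk-rows), and the insertion of a new letter fails precisely when
-- an increasing subsequence of length m + 1 appears (Av⇒rsk, rsk⇒Av). Both chains of a permutation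
-- add a box at every step, and the pairs of such chains are counted by a recursion over the boxes
-- that are added and removed (#Av↔ups).
--
-- The machine keeps the m counters in binary on one work tape, whose symbols are m-tuples of bits,
-- the least significant first. Adding or removing a box changes at most two counters by one; this
-- is done in one sweep with carries and borrows, and a path dies if a borrow is left over. The
-- input head counts the boxes. The inductive family Tree describes whole computation trees; a tree
-- yields termination, the space bound and the enumeration of the accepting paths (tree-acc,
-- tree-space, tree↔), and the tree of the machine is built along the recursion that counts the
-- walks (descend, ascend).

open import Defs
open import Axiom.UniquenessOfIdentityProofs.WithK using (uip)
open import Data.Bool.Base using (Bool; true; false; T; if_then_else_; _∨_)
import Data.Bool.Properties as Bool
open import Data.Fin.Base as Fin using (Fin; zero; suc; toℕ; inject₁)
import Data.Fin.Properties as Fin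
open import Data.List.Base as List using (List; []; _∷_; _++_; _ʳ++_; length; filter; tabulate)
import Data.List.Properties as List
open import Data.List.Membership.Propositional using () renaming (_∈_ to _∈ᴸ_)
open import Data.List.Membership.Propositional.Properties
  using (∈-lookup; ∈-filter⁺; ∈-filter⁻; ∈-allFin; ∈-cartesianProductWith⁺)
import Data.List.Relation.Unary.All as Listᴬ
open import Data.List.Relation.Unary.Any using (here; there; index)
open import Data.List.Relation.Unary.Any.Properties using (lookup-index)
open import Data.List.Relation.Unary.Unique.Propositional using ([]; _∷_)
  renaming (Unique to Uniqueᴸ)
open import Data.List.Relation.Unary.Unique.Propositional.Properties
  using (cartesianProductWith⁺; allFin⁺; filter⁺; tabulate⁺)
open import Data.Maybe.Base as Maybe using (Maybe; just; nothing)
open import Data.Maybe.Properties using (just-injective)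
open import Data.Nat.Base
  using (ℕ; zero; suc; NonZero; _+_; _*_; _^_; _⊔_; _≤_; _<_; z≤n; s≤s; s≤s⁻¹; z<s)
open import Data.Nat.Logarithm using (⌊log₂_⌋; ⌊log₂⌋-mono-≤; ⌊log₂[2^n]⌋≡n)
open import Data.Nat.Properties
open import Data.Product.Base using (∃; ∃₂; _×_; _,_; proj₁; proj₂)
import Data.Product.Function.Dependent.Propositional as Σ
open import Data.Product.Function.NonDependent.Propositional using (_×-↔_)
open import Data.Sum.Base using (_⊎_; inj₁; inj₂)
open import Data.Sum.Function.Propositional using (_⊎-↔_)
open import Data.Vec.Base as Vec using (Vec; []; _∷_; replicate; lookup; map; zipWith)
open import Data.Vec.Properties using (lookup-map; lookup-allFin; ∷-injective)
open import Data.Vec.Relation.Unary.All using (All; []; _∷_)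
open import Data.Vec.Relation.Unary.AllPairs using ([]; _∷_)
open import Data.Vec.Relation.Unary.Linked using (Linked; []; [-]; _∷_)
import Data.Vec.Relation.Unary.Linked.Properties as Linked
open import Data.Vec.Relation.Unary.Unique.Propositional using (Unique)
open import Function.Base using (flip; _∘_)
open import Function.Bundles using (_⇔_; mk⇔; module Equivalence; _↔_; mk↔ₛ′; Inverse)
open import Function.Properties.Inverse using (↔-refl; ↔-sym; ↔-trans)
open import Function.Related.Propositional using (bijection)
open import Induction.WellFounded using (Acc; acc)
open import Relation.Binary.Construct.Closure.ReflexiveTransitive using (ε; _◅_)
open import Relation.Binary.PropositionalEquality
open import Relation.Nullary.Decidable using (Dec; does; yes; no; map′)
open import Relation.Nullary.Negation using (¬_; contradiction)
open import Relation.Unary using (Decidable; _∈_)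

private variable
  k m n i j t : ℕ
  r s : Fin m
  d e ρ μ ν κ : Vec ℕ m
  A B : Set

-- Shapes and box additions

-- A partition λ₀ ≥ … ≥ λₘ₋₁ ≥ 0 is represented by its differences: entry r is λᵣ - λᵣ₊₁, where
-- λₘ = 0. Every vector of naturals is then a shape, and rows are numbered from 0.
Shape : ℕ → Set
Shape = Vec ℕ

∅ : Shape m
∅ {m} = replicate m 0

-- Step r d e: adding a box in row r turns d into e. Entry r increases by one; if r > 0, entry
-- r - 1, which has to be positive, decreases by one.
data Step : Fin m → Shape m → Shape m → Set where
  front : ∀ {a} {d : Shape m} → Step zero (a ∷ d) (suc a ∷ d)
  hop   : ∀ {a} {d e : Shape (suc m)} → Step zero d e → Step (suc zero) (suc a ∷ d) (a ∷ e)
  keep  : ∀ {r : Fin m} {a} {d e : Shape (suc m)} →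
          Step (suc r) d e → Step (suc (suc r)) (a ∷ d) (a ∷ e)

Edge : Shape m → Shape m → Set
Edge d e = ∃ λ r → Step r d e

no-step-into-∅ : ¬ Step r d ∅
no-step-into-∅ (hop ())
no-step-into-∅ (keep s) = no-step-into-∅ s

step-target-unique : (p q : ∃ (Step r d)) → p ≡ q
step-target-unique (_ , front)  (_ , front) = refl
step-target-unique (_ , hop s)  (_ , hop t) with refl ← step-target-unique (_ , s) (_ , t) = refl
step-target-unique (_ , keep s) (_ , keep t) with refl ← step-target-unique (_ , s) (_ , t) = refl

step-source-unique : (p q : ∃ λ d → Step r d e) → p ≡ q
step-source-unique (_ , front)  (_ , front) = refl
step-source-unique (_ , hop s)  (_ , hop t) with refl ← step-source-unique (_ , s) (_ , t) = refl
step-source-unique (_ , keep s) (_ , keep t) with refl ← step-source-unique (_ , s) (_ , t) = refl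

step-irrelevant : (p q : Step r d e) → p ≡ q
step-irrelevant p q with refl ← step-target-unique (_ , p) (_ , q) = refl

-- Diamond⁺ r s μ ν: a box in row r of μ and a box in row s of ν lead to the same shape κ.
-- Diamond⁻ r s μ ν: boxes in row s and row r of the same shape ρ lead to μ and ν, respectively.
Diamond⁺ Diamond⁻ : Fin m → Fin m → Shape m → Shape m → Set
Diamond⁺ r s μ ν = ∃ λ κ → Step r μ κ × Step s ν κ
Diamond⁻ r s μ ν = ∃ λ ρ → Step r ρ ν × Step s ρ μ

diamond⁺ : r ≢ s → Diamond⁻ r s μ ν → Diamond⁺ r s μ ν
diamond⁺ r≢s (_ , front  , front)  = contradiction refl r≢s
diamond⁺ r≢s (_ , front  , hop v)  = _ , front , hop v
diamond⁺ r≢s (_ , front  , keep v) = _ , front , keep v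
diamond⁺ r≢s (_ , hop h  , front)  = _ , hop h , front
diamond⁺ r≢s (_ , hop h  , hop v)  = contradiction refl r≢s
diamond⁺ r≢s (_ , hop h  , keep v)
  with _ , t , u ← diamond⁺ (λ ()) (_ , h , v) = _ , hop t , keep u
diamond⁺ r≢s (_ , keep h , front)  = _ , keep h , front
diamond⁺ r≢s (_ , keep h , hop v)
  with _ , t , u ← diamond⁺ (λ ()) (_ , h , v) = _ , keep t , hop u
diamond⁺ r≢s (_ , keep h , keep v)
  with _ , t , u ← diamond⁺ (λ p → r≢s (cong suc p)) (_ , h , v) = _ , keep t , keep u

diamond⁻ : r ≢ s → Diamond⁺ r s μ ν → Diamond⁻ r s μ ν
diamond⁻ r≢s (_ , front  , front)  = contradiction refl r≢s
diamond⁻ r≢s (_ , front  , hop u)  = _ , front , hop u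
diamond⁻ r≢s (_ , front  , keep u) = _ , front , keep u
diamond⁻ r≢s (_ , hop t  , front)  = _ , hop t , front
diamond⁻ r≢s (_ , hop t  , hop u)  = contradiction refl r≢s
diamond⁻ r≢s (_ , hop t  , keep u)
  with _ , h , v ← diamond⁻ (λ ()) (_ , t , u) = _ , hop h , keep v
diamond⁻ r≢s (_ , keep t , front)  = _ , keep t , front
diamond⁻ r≢s (_ , keep t , hop u)
  with _ , h , v ← diamond⁻ (λ ()) (_ , t , u) = _ , keep h , hop v
diamond⁻ r≢s (_ , keep t , keep u)
  with _ , h , v ← diamond⁻ (λ p → r≢s (cong suc p)) (_ , t , u) = _ , keep h , keep v

diamond⁺-unique : (p q : Diamond⁺ r s μ ν) → p ≡ q
diamond⁺-unique (_ , t , u) (_ , t′ , u′)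
  with refl ← step-target-unique (_ , t) (_ , t′) with refl ← step-irrelevant u u′ = refl

diamond⁻-unique : (p q : Diamond⁻ r s μ ν) → p ≡ q
diamond⁻-unique (_ , t , u) (_ , t′ , u′)
  with refl ← step-source-unique (_ , t) (_ , t′) with refl ← step-irrelevant u u′ = refl

-- Bumping

-- The boxes that can be added to μ and the boxes that can be removed from it, with the other end
-- of the edge.
Up Down : Shape m → Set
Up   μ = ∃₂ λ r κ → Step r μ κ
Down μ = ∃₂ λ r ρ → Step r ρ μ

-- Room μ: the last row of μ is empty, so that a row can be opened within the m rows.
data Room : Shape m → Set where
  one  : Room (0 ∷ [])
  more : ∀ {a b} {d : Shape m} → Room (b ∷ d) → Room (a ∷ b ∷ d)

-- A box addition of d, read in a ∷ d. Adding to the top row of d means adding to the second row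
-- of a ∷ d; if that row is as long as the first one, the box goes to the first row instead.
lift : ∀ a {d : Shape (suc m)} → Up d → Up (a ∷ d)
lift (suc a) (zero  , _ , t) = suc zero , _ , hop t
lift zero    (zero  , _ , _) = zero , _ , front
lift a       (suc r , _ , t) = suc (suc r) , _ , keep t

-- When the two edges into μ add the same box in row r, the next box goes to the topmost row of
-- the same length as row r, that is, to the next column.
bump : Step r ρ μ → Up μ
bump front            = _ , _ , front
bump (hop {a = a} v)  = lift a (bump v)
bump (keep {a = a} v) = lift a (bump v)

-- A new letter puts its box below the first column, in the first empty row.
newRow : Room μ → Up μ
newRow one              = _ , _ , front
newRow (more {a = a} p) = lift a (newRow p)

-- What lift becomes when a box addition is replaced by the element it comes from (unbump-lift,
-- bump-extend).
extend : ∀ a {d : Shape (suc m)} → Down d ⊎ Room d → Down (a ∷ d) ⊎ Room (a ∷ d)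
extend a             (inj₁ (zero  , _ , v)) = inj₁ (suc zero , _ , hop v)
extend a             (inj₁ (suc r , _ , v)) = inj₁ (suc (suc r) , _ , keep v)
extend a {_ ∷ _}     (inj₂ p)               = inj₂ (more p)

-- Inverse of bump and newRow: the box came from the last box of the previous column, and from a
-- new letter if there is no previous column.
unbump : Step r μ κ → Down μ ⊎ Room μ
unbump (front {a = suc a})               = inj₁ (zero , _ , front)
unbump (front {a = zero} {d = []})       = inj₂ one
unbump (front {a = zero} {d = b ∷ d})    = extend zero (unbump (front {a = b} {d = d}))
unbump (hop {a = a} t)                   = extend (suc a) (unbump t)
unbump (keep {a = a} t)                  = extend a (unbump t)

unbumpUp : Up μ → Down μ ⊎ Room μ
unbumpUp (_ , _ , t) = unbump t

bumpUp : Down μ ⊎ Room μ → Up μ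
bumpUp (inj₁ (_ , _ , v)) = bump v
bumpUp (inj₂ p)           = newRow p

unbump-lift : ∀ a {d : Shape (suc m)} (u : Up d) → unbumpUp (lift a u) ≡ extend a (unbumpUp u)
unbump-lift zero    (zero  , _ , front) = refl
unbump-lift (suc a) (zero  , _ , t)     = refl
unbump-lift zero    (suc r , _ , t)     = refl
unbump-lift (suc a) (suc r , _ , t)     = refl

unbump-bump : (v : Step r ρ μ) → unbumpUp (bump v) ≡ inj₁ (_ , _ , v)
unbump-bump front            = refl
unbump-bump (hop {a = a} v)  = trans (unbump-lift a (bump v)) (cong (extend a) (unbump-bump v))
unbump-bump (keep {a = a} v) = trans (unbump-lift a (bump v)) (cong (extend a) (unbump-bump v))

unbump-newRow : (p : Room μ) → unbumpUp (newRow p) ≡ inj₂ p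
unbump-newRow one              = refl
unbump-newRow (more {a = a} p) =
  trans (unbump-lift a (newRow p)) (cong (extend a) (unbump-newRow p))

unbump-bumpUp : (c : Down μ ⊎ Room μ) → unbumpUp (bumpUp c) ≡ c
unbump-bumpUp (inj₁ (_ , _ , v)) = unbump-bump v
unbump-bumpUp (inj₂ p)           = unbump-newRow p

bump-extend : ∀ a {d : Shape (suc m)} (c : Down d ⊎ Room d) →
              bumpUp (extend a c) ≡ lift a (bumpUp c)
bump-extend a         (inj₁ (zero  , _ , v)) = refl
bump-extend a         (inj₁ (suc r , _ , v)) = refl
bump-extend a {_ ∷ _} (inj₂ p)               = refl

bumpUp-unbump : (t : Step r μ κ) → bumpUp (unbump t) ≡ (_ , _ , t)
bumpUp-unbump (front {a = suc a})            = refl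
bumpUp-unbump (front {a = zero} {d = []})    = refl
bumpUp-unbump (front {a = zero} {d = b ∷ d}) =
  trans (bump-extend zero (unbump (front {a = b} {d = d})))
        (cong (lift zero) (bumpUp-unbump (front {a = b} {d = d})))
bumpUp-unbump (hop {a = a} t)      =
  trans (bump-extend (suc a) (unbump t)) (cong (lift (suc a)) (bumpUp-unbump t))
bumpUp-unbump (keep {a = zero} t)  =
  trans (bump-extend zero (unbump t)) (cong (lift zero) (bumpUp-unbump t))
bumpUp-unbump (keep {a = suc a} t) =
  trans (bump-extend (suc a) (unbump t)) (cong (lift (suc a)) (bumpUp-unbump t))

-- The local rule

-- Span and Cospan are the two halves of a square: the edges μ ← ρ → ν and the edges μ → κ ← ν.
-- New stands for a square with degenerate lower edges, ρ = μ = ν, in which a letter is placed.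
Span Cospan New : Shape m → Shape m → Set
Span   μ ν = ∃ λ ρ → Edge ρ μ × Edge ρ ν
Cospan μ ν = ∃ λ κ → Edge μ κ × Edge ν κ
New    μ ν = μ ≡ ν × Room μ

-- The degenerate case μ = ν, where both edges of a pair add the same box.
double⁺ : Up μ → Cospan μ μ
double⁺ (r , κ , t) = κ , (r , t) , (r , t)

double⁻ : Down μ ⊎ Room μ → Span μ μ ⊎ New μ μ
double⁻ (inj₁ (r , ρ , v)) = inj₁ (ρ , (r , v) , (r , v))
double⁻ (inj₂ p)           = inj₂ (refl , p)

diamond→cospan : Diamond⁺ r s μ ν → Cospan μ ν
diamond→cospan (κ , t , u) = κ , (_ , t) , (_ , u)

diamond→span : Diamond⁻ r s μ ν → Span μ ν ⊎ New μ ν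
diamond→span (ρ , h , v) = inj₁ (ρ , (_ , v) , (_ , h))

-- The local rule of the growth diagram: different boxes are added independently, equal boxes
-- are bumped, and a new letter opens a row.
closeSquare : Span μ ν ⊎ New μ ν → Cospan μ ν
closeSquare (inj₁ (ρ , (s , v) , (r , h))) with r Fin.≟ s
... | no r≢s   = diamond→cospan (diamond⁺ r≢s (ρ , h , v))
... | yes refl with refl ← step-target-unique (_ , v) (_ , h) = double⁺ (bump v)
closeSquare (inj₂ (refl , p)) = double⁺ (newRow p)

openSquare : Cospan μ ν → Span μ ν ⊎ New μ ν
openSquare (κ , (r , t) , (s , u)) with r Fin.≟ s
... | no r≢s   = diamond→span (diamond⁻ r≢s (κ , t , u))
... | yes refl with refl ← step-source-unique (_ , t) (_ , u) = double⁻ (unbump t)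

open-double⁺ : (u : Up μ) → openSquare (double⁺ u) ≡ double⁻ (unbumpUp u)
open-double⁺ (r , κ , t) with r Fin.≟ r
... | no r≢r = contradiction refl r≢r
... | yes refl with refl ← step-source-unique (_ , t) (_ , t) = refl

close-double⁻ : (c : Down μ ⊎ Room μ) → closeSquare (double⁻ c) ≡ double⁺ (bumpUp c)
close-double⁻ (inj₁ (r , ρ , v)) with r Fin.≟ r
... | no r≢r = contradiction refl r≢r
... | yes refl with refl ← step-target-unique (_ , v) (_ , v) = refl
close-double⁻ (inj₂ p) = refl

open-diamond⁺ : r ≢ s → (x : Diamond⁺ r s μ ν) (y : Diamond⁻ r s μ ν) →
               openSquare (diamond→cospan x) ≡ diamond→span y
open-diamond⁺ {r = r} {s} r≢s x y with r Fin.≟ s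
... | no _     = cong diamond→span (diamond⁻-unique _ y)
... | yes refl = contradiction refl r≢s

close-diamond⁻ : r ≢ s → (x : Diamond⁻ r s μ ν) (y : Diamond⁺ r s μ ν) →
               closeSquare (diamond→span x) ≡ diamond→cospan y
close-diamond⁻ {r = r} {s} r≢s x y with r Fin.≟ s
... | no _     = cong diamond→cospan (diamond⁺-unique _ y)
... | yes refl = contradiction refl r≢s

open-close : (x : Span μ ν ⊎ New μ ν) → openSquare (closeSquare x) ≡ x
open-close (inj₁ (ρ , (s , v) , (r , h))) with r Fin.≟ s
... | no r≢s = open-diamond⁺ r≢s _ (ρ , h , v)
... | yes refl with refl ← step-target-unique (_ , v) (_ , h) with refl ← step-irrelevant v h =
  trans (open-double⁺ (bump v)) (cong double⁻ (unbump-bump v))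
open-close (inj₂ (refl , p)) = trans (open-double⁺ (newRow p)) (cong double⁻ (unbump-newRow p))

close-open : (x : Cospan μ ν) → closeSquare (openSquare x) ≡ x
close-open (κ , (r , t) , (s , u)) with r Fin.≟ s
... | no r≢s = close-diamond⁻ r≢s _ (κ , t , u)
... | yes refl with refl ← step-source-unique (_ , t) (_ , u) with refl ← step-irrelevant t u =
  trans (close-double⁻ (unbump t)) (cong double⁺ (bumpUp-unbump t))

-- Numbers of rows

-- rows⁺ a h is the number of nonzero rows of a ∷ d if d has h of them: the rows of a ∷ d are those
-- of d and one more in front, which is nonzero as soon as a or h is.
rows⁺ : ℕ → ℕ → ℕ
rows⁺ zero    zero    = 0
rows⁺ (suc a) zero    = 1
rows⁺ a       (suc h) = suc (suc h)

rows : Shape m → ℕ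
rows []      = 0
rows (a ∷ d) = rows⁺ a (rows d)

rows-∅ : ∀ m → rows (∅ {m}) ≡ 0
rows-∅ zero = refl
rows-∅ (suc m) rewrite rows-∅ m = refl

-- A box can be added in a nonzero row or in the first empty one.
rows-step : Step r ρ μ → rows μ ≡ rows ρ ⊔ suc (toℕ r)
rows-step (front {a = a} {d}) with rows d
rows-step (front {a = zero})  | zero  = refl
rows-step (front {a = suc a}) | zero  = refl
rows-step (front {a = zero})  | suc h = refl
rows-step (front {a = suc a}) | suc h = refl
rows-step (hop {a = a} {d} {e} t) rewrite rows-step t with rows d
rows-step (hop {a = zero} t)  | zero  = refl
rows-step (hop {a = suc a} t) | zero  = refl
rows-step (hop {a = zero} t)  | suc h = refl
rows-step (hop {a = suc a} t) | suc h = refl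
rows-step (keep {a = a} {d} {e} t) rewrite rows-step t with rows d
rows-step (keep {a = zero} t)  | zero  = refl
rows-step (keep {a = suc a} t) | zero  = refl
rows-step (keep {a = zero} t)  | suc h = refl
rows-step (keep {a = suc a} t) | suc h = refl

row : Up μ → ℕ
row (r , _) = toℕ r

row-lift : ∀ a {d : Shape (suc m)} (u : Up d) → row (lift a u) ≤ suc (row u)
row-lift zero    (zero  , _ , _) = z≤n
row-lift (suc a) (zero  , _ , _) = ≤-refl
row-lift zero    (suc r , _ , _) = ≤-refl
row-lift (suc a) (suc r , _ , _) = ≤-refl

row-bump : (v : Step r ρ μ) → row (bump v) ≤ toℕ r
row-bump front            = z≤n
row-bump (hop {a = a} v)  = ≤-trans (row-lift a (bump v)) (s≤s (row-bump v))
row-bump (keep {a = a} v) = ≤-trans (row-lift a (bump v)) (s≤s (row-bump v))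

row-lift-top : ∀ a {d : Shape (suc m)} (u : Up d) → row u ≡ rows d →
                  row (lift a u) ≡ rows (a ∷ d)
row-lift-top zero    (zero  , _ , _) eq rewrite sym eq = refl
row-lift-top (suc a) (zero  , _ , _) eq rewrite sym eq = refl
row-lift-top zero    (suc r , _ , _) eq rewrite sym eq = refl
row-lift-top (suc a) (suc r , _ , _) eq rewrite sym eq = refl

row-newRow : (p : Room μ) → row (newRow p) ≡ rows μ
row-newRow one              = refl
row-newRow (more {a = a} p) = row-lift-top a (newRow p) (row-newRow p)

room? : (μ : Shape m) → Room μ ⊎ rows μ ≡ m
room? []           = inj₂ refl
room? (zero ∷ [])  = inj₁ one
room? (suc a ∷ []) = inj₂ refl
room? (a ∷ b ∷ d) with room? (b ∷ d)
... | inj₁ p = inj₁ (more p)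
... | inj₂ eq rewrite eq with a
...   | zero  = inj₂ refl
...   | suc _ = inj₂ refl

Room⇒rows< : {μ : Shape m} → Room μ → rows μ < m
Room⇒rows< {m = m} p = subst (_< m) (row-newRow p) (Fin.toℕ<n (proj₁ (newRow p)))

Room-irrelevant : (p q : Room μ) → p ≡ q
Room-irrelevant one      one      = refl
Room-irrelevant (more p) (more q) = cong more (Room-irrelevant p q)

⊔-distrib-⊔ : ∀ a b c → a ⊔ b ⊔ c ≡ (a ⊔ b) ⊔ (a ⊔ c)
⊔-distrib-⊔ a b c = begin
  a ⊔ b ⊔ c           ≡⟨ cong (λ z → z ⊔ b ⊔ c) (⊔-idem a) ⟨
  a ⊔ a ⊔ b ⊔ c       ≡⟨ cong (_⊔ c) (⊔-assoc a a b) ⟩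
  a ⊔ (a ⊔ b) ⊔ c     ≡⟨ cong (_⊔ c) (⊔-comm a (a ⊔ b)) ⟩
  (a ⊔ b) ⊔ a ⊔ c     ≡⟨ ⊔-assoc (a ⊔ b) a c ⟩
  (a ⊔ b) ⊔ (a ⊔ c)   ∎
  where open ≡-Reasoning

rows-diamond : Step r ρ ν → Step s ρ μ → Step r μ κ → rows κ ≡ rows μ ⊔ rows ν
rows-diamond {r = r} {ρ} {ν} {s = s} {μ} h v t
  rewrite rows-step t | rows-step h | rows-step v =
  ⊔-distrib-⊔ (rows ρ) (suc (toℕ s)) (suc (toℕ r))

rows-bump : (v : Step r ρ μ) → rows (proj₁ (proj₂ (bump v))) ≡ rows μ
rows-bump {r = r} {ρ} {μ} v = begin
  rows (proj₁ (proj₂ (bump v)))     ≡⟨ rows-step (proj₂ (proj₂ (bump v))) ⟩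
  rows μ ⊔ suc (row (bump v))    ≡⟨ m≥n⇒m⊔n≡m (≤-trans (s≤s (row-bump v)) below) ⟩
  rows μ                            ∎
  where
  open ≡-Reasoning
  below : suc (toℕ r) ≤ rows μ
  below = subst (suc (toℕ r) ≤_) (sym (rows-step v)) (m≤n⊔m (rows ρ) (suc (toℕ r)))

-- Without a new letter, the top of a square has as many rows as the longer one of its sides.
rows-closeSquare : (x : Span μ ν) → rows (proj₁ (closeSquare (inj₁ x))) ≡ rows μ ⊔ rows ν
rows-closeSquare (ρ , (s , v) , (r , h)) with r Fin.≟ s
... | no r≢s   = rows-diamond h v (proj₁ (proj₂ (diamond⁺ r≢s (ρ , h , v))))
rows-closeSquare {μ = μ} (ρ , (s , v) , (r , h)) | yes refl
  with refl ← step-target-unique (_ , v) (_ , h) =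
  trans (rows-bump v) (sym (⊔-idem (rows μ)))

rows-new : (p : Room μ) → rows (proj₁ (proj₂ (newRow p))) ≡ suc (rows μ)
rows-new {μ = μ} p = begin
  rows (proj₁ (proj₂ (newRow p)))   ≡⟨ rows-step (proj₂ (proj₂ (newRow p))) ⟩
  rows μ ⊔ suc (row (newRow p))  ≡⟨ cong (λ z → rows μ ⊔ suc z) (row-newRow p) ⟩
  rows μ ⊔ suc (rows μ)             ≡⟨ m≤n⇒m⊔n≡n (n≤1+n (rows μ)) ⟩
  suc (rows μ)                      ∎
  where open ≡-Reasoning

-- Insertion and removal of a letter

-- A chain of shapes from ∅ in which every link keeps the shape or adds a box. The link at depth
-- c, counted from the outermost one, belongs to the letter c and adds a box if that letter has
-- been inserted; the shape inside a link is spanned by the larger letters.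
data Chain {m} : ℕ → Shape m → Set where
  nil  : Chain 0 ∅
  skip : Chain n ρ → Chain (suc n) ρ
  add  : Chain n ρ → Edge ρ μ → Chain (suc n) μ

-- A chain whose final shape κ arises from ν by adding a box, with that box.
Enlarged : ℕ → Shape m → Set
Enlarged n ν = ∃ λ κ → Chain n κ × Edge ν κ

-- One column of the growth diagram: below-new places a letter there, below-skip and below-add
-- carry the added box past a link of the old chain.
below-new : Chain n ν → Room ν → Enlarged (suc n) ν
below-new C p = let κ , t , u = closeSquare (inj₂ (refl , p)) in κ , add C t , u

below-skip : Enlarged n ν → Enlarged (suc n) ν
below-skip (κ , C , u) = κ , skip C , u

below-add : Edge ρ ν → Enlarged n ρ → Enlarged (suc n) ν
below-add h (μ , C , v) = let κ , t , u = closeSquare (inj₁ (_ , v , h)) in κ , add C t , u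

-- Insertion of the letter c. It fails if c is in use, and if there is no room for the row that
-- c opens.
insert : Chain n ν → Fin n → Maybe (Enlarged n ν)
insert {ν = ν} (skip C) zero with room? ν
... | inj₁ p = just (below-new C p)
... | inj₂ _ = nothing
insert (add C h) zero    = nothing
insert (skip C)  (suc c) = Maybe.map below-skip (insert C c)
insert (add C h) (suc c) = Maybe.map (below-add h) (insert C c)

-- A chain with a letter: the result of undoing an insertion.
Marked : ℕ → Shape m → Set
Marked n ν = Chain n ν × Fin n

mutual
  remove : Chain n κ → Edge ν κ → Marked n ν
  remove nil       (_ , u) = contradiction u no-step-into-∅
  remove (skip C)  u       = let D , c = remove C u in skip D , suc c
  remove (add C t) u       = removeTop C (openSquare (_ , t , u))

  removeTop : Chain n μ → Span μ ν ⊎ New μ ν → Marked (suc n) ν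
  removeTop C (inj₁ (ρ , v , h))  = let D , c = remove C v in add D h , suc c
  removeTop C (inj₂ (refl , p))   = skip C , zero

remove-insert : (C : Chain n ν) (c : Fin n) {C⁺ : Enlarged n ν} →
                insert C c ≡ just C⁺ →
                remove (proj₁ (proj₂ C⁺)) (proj₂ (proj₂ C⁺)) ≡ (C , c)
remove-insert {ν = ν} (skip C) zero eq with room? ν
remove-insert (skip C) zero refl | inj₁ p =
  cong (removeTop C) (open-close (inj₂ (refl , p)))
remove-insert (skip C) (suc c) eq with insert C c in eq′
remove-insert (skip C) (suc c) refl | just _ rewrite remove-insert C c eq′ = refl
remove-insert (add C h) (suc c) eq with insert C c in eq′
remove-insert (add C h) (suc c) refl | just (μ , C′ , v)
  rewrite open-close (inj₁ (_ , v , h)) | remove-insert C c eq′ = refl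

room?-yes : (p : Room ν) → room? ν ≡ inj₁ p
room?-yes {ν = ν} p with room? ν
... | inj₁ q  = cong inj₁ (Room-irrelevant q p)
... | inj₂ eq = contradiction eq (<⇒≢ (Room⇒rows< p))

mutual
  insert-remove : (C : Chain n κ) (u : Edge ν κ) →
                  insert (proj₁ (remove C u)) (proj₂ (remove C u)) ≡ just (κ , C , u)
  insert-remove nil       (_ , u) = contradiction u no-step-into-∅
  insert-remove (skip C)  u       = cong (Maybe.map below-skip) (insert-remove C u)
  insert-remove (add C t) u       =
    trans (insert-removeTop C (openSquare (_ , t , u)))
          (cong (λ (κ , t , u) → just (κ , add C t , u)) (close-open (_ , t , u)))

  insert-removeTop : (C : Chain n μ) (x : Span μ ν ⊎ New μ ν) →
    insert (proj₁ (removeTop C x)) (proj₂ (removeTop C x)) ≡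
    just (let κ , t , u = closeSquare x in κ , add C t , u)
  insert-removeTop C (inj₁ (ρ , v , h)) = cong (Maybe.map (below-add h)) (insert-remove C v)
  insert-removeTop C (inj₂ (refl , p)) rewrite room?-yes p = refl

-- The correspondence

-- Walks from ∅ that add a box at every step.
data Walk {m} : ℕ → Shape m → Set where
  []  : Walk 0 ∅
  _∷_ : Edge ν κ → Walk i ν → Walk (suc i) κ

-- The insertion chain and the recording walk of a word of length i over n letters; they end in
-- the same shape.
Pair : ∀ m → ℕ → ℕ → Set
Pair m n i = ∃ λ (κ : Shape m) → Chain n κ × Walk i κ

-- The chain in which no letter has been inserted.
empty : ∀ n → Chain {m} n ∅
empty zero    = nil
empty (suc n) = skip (empty n)

insertPair : Fin n → Pair m n i → Maybe (Pair m n (suc i))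
insertPair c (ν , C , Q) = Maybe.map (λ (κ , C′ , u) → κ , C′ , u ∷ Q) (insert C c)

-- The letters are inserted from the last one to the first one: when c is inserted, the letters > c
-- that follow c in the word are the ones inserted inside its link.
rsk : Vec (Fin n) i → Maybe (Pair m n i)
rsk []      = just (∅ , empty _ , [])
rsk (c ∷ w) = rsk w Maybe.>>= insertPair c

unrsk : Pair m n i → Vec (Fin n) i
unrsk (κ , C , [])    = []
unrsk (κ , C , u ∷ Q) = let D , c = remove C u in c ∷ unrsk (_ , D , Q)

unrsk-rsk : (w : Vec (Fin n) i) {b : Pair m n i} → rsk w ≡ just b → unrsk b ≡ w
unrsk-rsk []      refl = refl
unrsk-rsk {m = m} (c ∷ w) eq with rsk {m = m} w in eq₁
unrsk-rsk (c ∷ w) eq   | just (ν , C , Q) with insert C c in eq₂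
unrsk-rsk (c ∷ w) refl | just (ν , C , Q) | just _
  rewrite remove-insert C c eq₂ = cong (c ∷_) (unrsk-rsk w eq₁)

empty-unique : (C : Chain n (∅ {m})) → C ≡ empty n
empty-unique {n} C = go C refl
  where
  go : ∀ {n κ} (C : Chain n κ) (eq : κ ≡ ∅) → subst (Chain n) eq C ≡ empty n
  go nil              refl = refl
  go (skip C)         refl = cong skip (go C refl)
  go (add C (_ , u))  refl = contradiction u no-step-into-∅

rsk-unrsk : (b : Pair m n i) → rsk (unrsk b) ≡ just b
rsk-unrsk (_ , C , [])    = cong (λ C → just (_ , C , [])) (sym (empty-unique C))
rsk-unrsk (_ , C , u ∷ Q)
  rewrite rsk-unrsk (_ , proj₁ (remove C u) , Q) | insert-remove C u = refl

-- Row counts and longest increasing subsequences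

rows≤m : (μ : Shape m) → rows μ ≤ m
rows≤m μ with room? μ
... | inj₁ p  = <⇒≤ (Room⇒rows< p)
... | inj₂ eq = ≤-reflexive eq

-- The number of rows of the shape spanned by the letters ≥ j in a chain.
rowsFrom : ℕ → Chain {m} n κ → ℕ
rowsFrom {κ = κ} zero C = rows κ
rowsFrom (suc j) nil       = 0
rowsFrom (suc j) (skip C)  = rowsFrom j C
rowsFrom (suc j) (add C _) = rowsFrom j C

-- raise c j x y is x ⊔ y if j ≤ c, and x otherwise.
raise : Fin n → ℕ → ℕ → ℕ → ℕ
raise c       zero    x y = x ⊔ y
raise zero    (suc j) x y = x
raise (suc c) (suc j) x y = raise c j x y

-- The length of a longest increasing subsequence of w with all letters ≥ j: the first letter c
-- can only be followed by letters > c.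
lis : ℕ → Vec (Fin n) i → ℕ
lis j []      = 0
lis j (c ∷ w) = raise c j (lis j w) (suc (lis (suc (toℕ c)) w))

rowsFrom-insert : (C : Chain {m} n ν) (c : Fin n) {C⁺ : Enlarged n ν} →
  insert C c ≡ just C⁺ → ∀ j →
  rowsFrom j (proj₁ (proj₂ C⁺)) ≡ raise c j (rowsFrom j C) (suc (rowsFrom (suc (toℕ c)) C))
rowsFrom-insert {ν = ν} (skip C) zero eq j with room? ν
rowsFrom-insert {ν = ν} (skip C) zero refl zero    | inj₁ p =
  trans (rows-new p) (sym (m≤n⇒m⊔n≡n (n≤1+n (rows ν))))
rowsFrom-insert (skip C) zero refl (suc j) | inj₁ p = refl
rowsFrom-insert (skip C) (suc c) eq j with insert C c in eq′
rowsFrom-insert (skip C) (suc c) refl zero    | just _ = rowsFrom-insert C c eq′ zero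
rowsFrom-insert (skip C) (suc c) refl (suc j) | just _ = rowsFrom-insert C c eq′ j
rowsFrom-insert (add C h) (suc c) eq j with insert C c in eq′
rowsFrom-insert (add C h) (suc c) refl (suc j) | just _ = rowsFrom-insert C c eq′ j
rowsFrom-insert {ν = ν} (add {ρ = ρ} C h) (suc c) refl zero | just (μ , C′ , v) = begin
  rows (proj₁ (closeSquare (inj₁ (ρ , v , h))))   ≡⟨ rows-closeSquare (ρ , v , h) ⟩
  rows μ ⊔ rows ν                         ≡⟨ cong (_⊔ rows ν) (rowsFrom-insert C c eq′ zero) ⟩
  rows ρ ⊔ x ⊔ rows ν                     ≡⟨ ⊔-comm _ (rows ν) ⟩
  rows ν ⊔ (rows ρ ⊔ x)                   ≡⟨ ⊔-assoc (rows ν) (rows ρ) x ⟨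
  rows ν ⊔ rows ρ ⊔ x                     ≡⟨ cong (_⊔ x) (m≥n⇒m⊔n≡m ρ≤ν) ⟩
  rows ν ⊔ x                              ∎
  where
  open ≡-Reasoning
  x = suc (rowsFrom (suc (toℕ c)) C)
  ρ≤ν : rows ρ ≤ rows ν
  ρ≤ν = subst (rows ρ ≤_) (sym (rows-step (proj₂ h))) (m≤m⊔n _ _)

-- Free C c: the letter c has not been inserted in C.
data Free {m} : Chain {m} n κ → Fin n → Set where
  here : {C : Chain n ρ} → Free (skip C) zero
  past-skip : ∀ {C : Chain n ρ} {c} → Free C c → Free (skip C) (suc c)
  past-add : ∀ {C : Chain n ρ} {u : Edge ρ μ} {c} → Free C c → Free (add C u) (suc c)

insert-total : {C : Chain {m} n ν} {c : Fin n} → Free C c → rowsFrom (suc (toℕ c)) C < m →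
               ∃ λ C⁺ → insert C c ≡ just C⁺
insert-total {ν = ν} here lt with room? ν
... | inj₁ p  = _ , refl
... | inj₂ eq = contradiction eq (<⇒≢ lt)
insert-total (past-skip f) lt with _ , eq ← insert-total f lt rewrite eq = _ , refl
insert-total (past-add f) lt with _ , eq ← insert-total f lt rewrite eq = _ , refl

insert-free : (C : Chain {m} n ν) (c : Fin n) {C⁺ : Enlarged n ν} → insert C c ≡ just C⁺ → Free C c
insert-free (skip C) zero eq = here
insert-free (skip C) (suc c) eq with insert C c in eq′
insert-free (skip C) (suc c) refl | just _ = past-skip (insert-free C c eq′)
insert-free (add C _) (suc c) eq with insert C c in eq′
insert-free (add C _) (suc c) refl | just _ = past-add (insert-free C c eq′)

free-insert : (C : Chain {m} n ν) (c : Fin n) {C⁺ : Enlarged n ν} → insert C c ≡ just C⁺ →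
              ∀ a → Free (proj₁ (proj₂ C⁺)) a ⇔ (a ≢ c × Free C a)
free-insert C c eq a = mk⇔ (to C c eq) (λ (a≢c , f) → from C c eq a≢c f)
  where
  to : (C : Chain {m} n ν) (c : Fin n) {C⁺ : Enlarged n ν} → insert C c ≡ just C⁺ →
       ∀ {a} → Free (proj₁ (proj₂ C⁺)) a → a ≢ c × Free C a
  to {ν = ν} (skip C) zero eq f with room? ν
  to (skip C) zero refl (past-add f) | inj₁ _ = (λ ()) , past-skip f
  to (skip C) (suc c) eq f with insert C c in eq′
  to (skip C) (suc c) refl here | just _ = (λ ()) , here
  to (skip C) (suc c) refl (past-skip f) | just _ =
    let a≢c , f′ = to C c eq′ f in (λ { refl → a≢c refl }) , past-skip f′
  to (add C _) (suc c) eq f with insert C c in eq′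
  to (add C _) (suc c) refl (past-add f) | just _ =
    let a≢c , f′ = to C c eq′ f in (λ { refl → a≢c refl }) , past-add f′

  from : (C : Chain {m} n ν) (c : Fin n) {C⁺ : Enlarged n ν} → insert C c ≡ just C⁺ →
         ∀ {a} → a ≢ c → Free C a → Free (proj₁ (proj₂ C⁺)) a
  from {ν = ν} (skip C) zero eq a≢c f with room? ν
  from (skip C) zero refl a≢c here | inj₁ _ = contradiction refl a≢c
  from (skip C) zero refl a≢c (past-skip f) | inj₁ _ = past-add f
  from (skip C) (suc c) eq a≢c f with insert C c in eq′
  from (skip C) (suc c) refl a≢c here | just _ = here
  from (skip C) (suc c) refl a≢c (past-skip f) | just _ =
    past-skip (from C c eq′ (λ p → a≢c (cong suc p)) f)
  from (add C _) (suc c) eq a≢c f with insert C c in eq′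
  from (add C _) (suc c) refl a≢c (past-add f) | just _ =
    past-add (from C c eq′ (λ p → a≢c (cong suc p)) f)

free-empty : (c : Fin n) → Free (empty {m} n) c
free-empty zero    = here
free-empty (suc c) = past-skip (free-empty c)

rowsFrom-empty : ∀ n j → rowsFrom j (empty {m} n) ≡ 0
rowsFrom-empty {m} n       zero    = rows-∅ m
rowsFrom-empty     zero    (suc j) = refl
rowsFrom-empty     (suc n) (suc j) = rowsFrom-empty n j

rsk-unique : (w : Vec (Fin n) i) {b : Pair m n i} → rsk w ≡ just b →
             Unique w × (∀ a → Free (proj₁ (proj₂ b)) a ⇔ All (a ≢_) w)
rsk-unique []      refl = [] , λ a → mk⇔ (λ _ → []) (λ _ → free-empty a)
rsk-unique {m = m} (c ∷ w) eq with rsk {m = m} w in eq₁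
rsk-unique (c ∷ w) eq   | just (ν , C , Q) with insert C c in eq₂
rsk-unique (c ∷ w) refl | just (ν , C , Q) | just (_ , C′ , _)
  with w! , free ← rsk-unique w eq₁ =
    (Equivalence.to (free c) (insert-free C c eq₂) ∷ w!) ,
    λ a → mk⇔
      (λ f → let a≢c , f′ = Equivalence.to (free-insert C c eq₂ a) f in
             a≢c ∷ Equivalence.to (free a) f′)
      (λ { (a≢c ∷ a∉w) →
             Equivalence.from (free-insert C c eq₂ a) (a≢c , Equivalence.from (free a) a∉w) })

rsk-rows : (w : Vec (Fin n) i) {b : Pair m n i} → rsk w ≡ just b →
           ∀ j → rowsFrom j (proj₁ (proj₂ b)) ≡ lis j w
rsk-rows {n = n} []      refl j = rowsFrom-empty n j
rsk-rows {m = m} (c ∷ w) eq j with rsk {m = m} w in eq₁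
rsk-rows (c ∷ w) eq j   | just (ν , C , Q) with insert C c in eq₂
rsk-rows (c ∷ w) refl j | just (ν , C , Q) | just (_ , C′ , _) =
  trans (rowsFrom-insert C c eq₂ j)
        (cong₂ (raise c j) (rsk-rows w eq₁ j) (cong suc (rsk-rows w eq₁ (suc (toℕ c)))))

rsk-lis : (w : Vec (Fin n) i) {b : Pair m n i} → rsk w ≡ just b → lis 0 w ≤ m
rsk-lis w {κ , _} eq = subst (_≤ _) (rsk-rows w eq 0) (rows≤m κ)

rsk-total : (w : Vec (Fin n) i) → Unique w → lis 0 w ≤ m → ∃ λ (b : Pair m n i) → rsk w ≡ just b
rsk-total []      _            _  = _ , refl
rsk-total {m = m} (c ∷ w) (c∉w ∷ w!) le
  with (ν , C , Q) , eq ← rsk-total {m = m} w w! (m⊔n≤o⇒m≤o (lis 0 w) _ le)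
  with C⁺ , eq′ ← insert-total {C = C} (Equivalence.from (proj₂ (rsk-unique w eq) c) c∉w)
         (subst (_< m) (sym (rsk-rows w eq (suc (toℕ c)))) (m⊔n≤o⇒n≤o (lis 0 w) _ le))
  rewrite eq | eq′ = _ , refl

-- Increasing subsequences as occurrences of a pattern

-- Inc k j w: w has an increasing subsequence of length k with all letters ≥ j.
data Inc {n} : ℕ → ℕ → Vec (Fin n) i → Set where
  none : ∀ {w : Vec (Fin n) i} → Inc 0 j w
  skip : ∀ {c} {w : Vec (Fin n) i} → Inc k j w → Inc k j (c ∷ w)
  take : ∀ {c} {w : Vec (Fin n) i} → j ≤ toℕ c → Inc k (suc (toℕ c)) w → Inc (suc k) j (c ∷ w)

raise-≥ˡ : ∀ (c : Fin n) j {x y} → x ≤ raise c j x y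
raise-≥ˡ c       zero    = m≤m⊔n _ _
raise-≥ˡ zero    (suc j) = ≤-refl
raise-≥ˡ (suc c) (suc j) = raise-≥ˡ c j

raise-≥ʳ : ∀ (c : Fin n) j {x y} → j ≤ toℕ c → y ≤ raise c j x y
raise-≥ʳ c       zero    _  = m≤n⊔m _ _
raise-≥ʳ (suc c) (suc j) le = raise-≥ʳ c j (s≤s⁻¹ le)

raise-≤ : ∀ (c : Fin n) j {x y} → k ≤ raise c j x y → k ≤ x ⊎ (j ≤ toℕ c × k ≤ y)
raise-≤ c zero {x} {y} le with ⊔-sel x y
... | inj₁ eq = inj₁ (subst (_ ≤_) eq le)
... | inj₂ eq = inj₂ (z≤n , subst (_ ≤_) eq le)
raise-≤ zero    (suc j) le = inj₁ le
raise-≤ (suc c) (suc j) le with raise-≤ c j le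
... | inj₁ p       = inj₁ p
... | inj₂ (p , q) = inj₂ (s≤s p , q)

Inc⇒≤lis : {w : Vec (Fin n) i} → Inc k j w → k ≤ lis j w
Inc⇒≤lis none = z≤n
Inc⇒≤lis {j = j} (skip {c = c} p)    = ≤-trans (Inc⇒≤lis p) (raise-≥ˡ c j)
Inc⇒≤lis {j = j} (take {c = c} le p) = ≤-trans (s≤s (Inc⇒≤lis p)) (raise-≥ʳ c j le)

≤lis⇒Inc : ∀ k j (w : Vec (Fin n) i) → k ≤ lis j w → Inc k j w
≤lis⇒Inc zero    j w       le = none
≤lis⇒Inc (suc k) j (c ∷ w) le with raise-≤ c j le
... | inj₁ p       = skip (≤lis⇒Inc (suc k) j w p)
... | inj₂ (p , q) = take p (≤lis⇒Inc k (suc (toℕ c)) w (s≤s⁻¹ q))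

-- v lists increasing positions of w at which w increases.
Increasing : Vec (Fin n) i → Vec (Fin i) k → Set
Increasing w v = ∀ a b → a Fin.< b →
  lookup v a Fin.< lookup v b × lookup w (lookup v a) Fin.< lookup w (lookup v b)

AtLeast : ℕ → Vec (Fin n) i → Vec (Fin i) k → Set
AtLeast j w v = ∀ a → j ≤ toℕ (lookup w (lookup v a))

Inc⇒Increasing : {w : Vec (Fin n) i} → Inc k j w →
                 ∃ λ (v : Vec (Fin i) k) → Increasing w v × AtLeast j w v
Inc⇒Increasing none = [] , (λ ()) , (λ ())
Inc⇒Increasing {w = c ∷ w} (skip p) with v , inc , ge ← Inc⇒Increasing p =
  map suc v , inc′ , ge′
  where
  inc′ : Increasing (c ∷ w) (map suc v)
  inc′ a b a<b rewrite lookup-map a Fin.suc v | lookup-map b Fin.suc v =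
    let x , y = inc a b a<b in s≤s x , y
  ge′ : AtLeast _ (c ∷ w) (map suc v)
  ge′ a rewrite lookup-map a Fin.suc v = ge a
Inc⇒Increasing {j = j} {w = c ∷ w} (take le p) with v , inc , ge ← Inc⇒Increasing p =
  zero ∷ map suc v , inc′ , ge′
  where
  inc′ : Increasing (c ∷ w) (zero ∷ map suc v)
  inc′ zero    (suc b) a<b rewrite lookup-map b Fin.suc v = z<s , ge b
  inc′ (suc a) (suc b) a<b rewrite lookup-map a Fin.suc v | lookup-map b Fin.suc v =
    let x , y = inc a b (s≤s⁻¹ a<b) in s≤s x , y
  ge′ : AtLeast j (c ∷ w) (zero ∷ map suc v)
  ge′ zero = le
  ge′ (suc a) rewrite lookup-map a Fin.suc v = ≤-trans le (<⇒≤ (ge a))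

positive⇒map-suc : (v : Vec (Fin (suc n)) k) → (∀ a → 0 < toℕ (lookup v a)) →
                   ∃ λ v′ → v ≡ map suc v′
positive⇒map-suc []          _   = [] , refl
positive⇒map-suc (zero ∷ v)  pos = contradiction (pos zero) λ ()
positive⇒map-suc (suc x ∷ v) pos with v′ , refl ← positive⇒map-suc v (λ a → pos (suc a)) =
  x ∷ v′ , refl

tail-increasing : ∀ {c} {w : Vec (Fin n) i} (v : Vec (Fin i) k) →
                  Increasing (c ∷ w) (map suc v) → Increasing w v
tail-increasing v inc a b a<b with p ← inc a b a<b
  rewrite lookup-map a Fin.suc v | lookup-map b Fin.suc v = s≤s⁻¹ (proj₁ p) , proj₂ p

tail-atLeast : ∀ {c} {w : Vec (Fin n) i} (v : Vec (Fin i) k) →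
               AtLeast j (c ∷ w) (map suc v) → AtLeast j w v
tail-atLeast v ge a with p ← ge a rewrite lookup-map a Fin.suc v = p

Increasing⇒Inc : (w : Vec (Fin n) i) (v : Vec (Fin i) k) →
                 Increasing w v → AtLeast j w v → Inc k j w
Increasing⇒Inc w       []         inc ge = none
Increasing⇒Inc (c ∷ w) (zero ∷ v) inc ge
  with v′ , refl ← positive⇒map-suc v (λ a → proj₁ (inc zero (suc a) z<s)) =
  take (ge zero) (Increasing⇒Inc w v′
    (tail-increasing v′ (λ a b a<b → inc (suc a) (suc b) (s≤s a<b)))
    (tail-atLeast v′ (λ a → proj₂ (inc zero (suc a) z<s))))
Increasing⇒Inc (c ∷ w) (suc x ∷ v) inc ge
  with v′ , refl ← positive⇒map-suc v (λ a → <-trans z<s (proj₁ (inc zero (suc a) z<s))) =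
  skip (Increasing⇒Inc w (x ∷ v′) (tail-increasing (x ∷ v′) inc) (tail-atLeast (x ∷ v′) ge))

increasing⇒Linked : (v : Vec (Fin n) k) →
                    (∀ a b → a Fin.< b → lookup v a Fin.< lookup v b) → Linked Fin._<_ v
increasing⇒Linked []          inc = []
increasing⇒Linked (x ∷ [])    inc = [-]
increasing⇒Linked (x ∷ y ∷ v) inc =
  inc zero (suc zero) z<s ∷ increasing⇒Linked (y ∷ v) (λ a b a<b → inc (suc a) (suc b) (s≤s a<b))

occurrence⇔ : ∀ k (w : Vec (Fin n) n) → ∃ (IsOccurrence (increasing k) w) ⇔ k ≤ lis 0 w
occurrence⇔ k w = mk⇔ to from
  where
  lookup-< : ∀ {a b : Fin k} → a Fin.< b → lookup (increasing k) a Fin.< lookup (increasing k) b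
  lookup-< {a} {b} a<b rewrite lookup-allFin a | lookup-allFin b = a<b
  to : ∃ (IsOccurrence (increasing k) w) → k ≤ lis 0 w
  to (v , linked , occ) = Inc⇒≤lis (Increasing⇒Inc w v
    (λ a b a<b → Linked.lookup⁺ <-trans linked a<b ,
                 Equivalence.from (occ a b a<b) (lookup-< a<b))
    (λ _ → z≤n))
  from : k ≤ lis 0 w → ∃ (IsOccurrence (increasing k) w)
  from le with v , inc , _ ← Inc⇒Increasing (≤lis⇒Inc k 0 w le) =
    v , increasing⇒Linked v (λ a b a<b → proj₁ (inc a b a<b)) ,
    λ a b a<b → mk⇔ (λ _ → lookup-< a<b) (λ _ → proj₂ (inc a b a<b))

Av⇒rsk : {w : Vec (Fin n) n} → Av n (increasing (suc m)) w → ∃ λ (b : Pair m n n) → rsk w ≡ just b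
Av⇒rsk {m = m} {w} (w! , avoids) =
  rsk-total w w! (≮⇒≥ λ lt → avoids (Equivalence.from (occurrence⇔ (suc m) w) lt))

rsk⇒Av : {w : Vec (Fin n) n} {b : Pair m n n} → rsk w ≡ just b → Av n (increasing (suc m)) w
rsk⇒Av {m = m} {w} eq =
  proj₁ (rsk-unique w eq) ,
  λ occ → <⇒≱ (Equivalence.to (occurrence⇔ (suc m) w) occ) (rsk-lis w eq)

-- Enumeration of the avoiding permutations

unique⇒lookup-injective : {xs : List A} → Uniqueᴸ xs →
                          ∀ i j → List.lookup xs i ≡ List.lookup xs j → i ≡ j
unique⇒lookup-injective (_    ∷ _)   zero    zero    _  = refl
unique⇒lookup-injective (x∉xs ∷ _)   zero    (suc j) eq =
  contradiction eq (Listᴬ.lookup x∉xs (∈-lookup j))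
unique⇒lookup-injective (x∉xs ∷ _)   (suc i) zero    eq =
  contradiction (sym eq) (Listᴬ.lookup x∉xs (∈-lookup i))
unique⇒lookup-injective (_    ∷ xs!) (suc i) (suc j) eq =
  cong suc (unique⇒lookup-injective xs! i j eq)

-- If a partial map f is defined exactly on P and has g as its inverse, then the elements of P in
-- a complete list without repetitions are counted by the codomain of f.
module _ {P : A → Set} (P? : Decidable P)
         {xs : List A} (xs! : Uniqueᴸ xs) (complete : ∀ a → a ∈ᴸ xs)
         (f : A → Maybe B) (g : B → A)
         (total : ∀ {a} → P a → ∃ λ b → f a ≡ just b) (sound : ∀ {a b} → f a ≡ just b → P a)
         (g∘f : ∀ a {b} → f a ≡ just b → g b ≡ a) (f∘g : ∀ b → f (g b) ≡ just b) where

  private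
    ys = filter P? xs

    image : (i : Fin (length ys)) → ∃ λ b → f (List.lookup ys i) ≡ just b
    image i = total (proj₂ (∈-filter⁻ P? {xs = xs} (∈-lookup i)))

    listed : ∀ b → g b ∈ᴸ ys
    listed b = ∈-filter⁺ P? (complete (g b)) (sound (f∘g b))

  filter-↔ : Fin (length ys) ↔ B
  filter-↔ = mk↔ₛ′ (λ i → proj₁ (image i)) (λ b → index (listed b))
    (λ b → just-injective (trans (sym (proj₂ (image (index (listed b)))))
             (trans (cong f (sym (lookup-index (listed b)))) (f∘g b))))
    (λ i → unique⇒lookup-injective (filter⁺ P? xs!) _ i
             (trans (sym (lookup-index (listed _))) (g∘f _ (proj₂ (image i)))))

words-unique : ∀ n i → Uniqueᴸ (words n i)
words-unique n zero    = Listᴬ.[] ∷ []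
words-unique n (suc i) = cartesianProductWith⁺ _∷_ ∷-injective (allFin⁺ n) (words-unique n i)

words-complete : (w : Vec (Fin n) i) → w ∈ᴸ words n i
words-complete []      = here refl
words-complete (c ∷ w) = ∈-cartesianProductWith⁺ _∷_ (∈-allFin c) (words-complete w)

#Av↔Pair : ∀ m n → Fin (#Av n (increasing (suc m))) ↔ Pair m n n
#Av↔Pair m n = filter-↔ (Av? n (increasing (suc m))) (words-unique n n) words-complete
  rsk unrsk Av⇒rsk rsk⇒Av unrsk-rsk rsk-unrsk

-- Numbers of boxes

-- The number of boxes: Vec.sum of a shape is the length of its top row, and a ∷ d without its top
-- row is d.
size : Shape m → ℕ
size []      = 0
size (a ∷ d) = (a + Vec.sum d) + size d

sum-front : Step zero d e → Vec.sum e ≡ suc (Vec.sum d)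
sum-front front = refl

sum-later : {r : Fin m} {d e : Shape (suc m)} → Step (suc r) d e → Vec.sum e ≡ Vec.sum d
sum-later (hop {a = a} s)  = trans (cong (a +_) (sum-front s)) (+-suc a _)
sum-later (keep {a = a} s) = cong (a +_) (sum-later s)

size-step : {r : Fin m} → Step r d e → size e ≡ suc (size d)
size-step front = refl
size-step (hop {a = a} {d = d} s) rewrite sum-front s | size-step s =
  trans (+-suc (a + suc (Vec.sum d)) (size d)) (cong (λ z → suc (z + size d)) (+-suc a (Vec.sum d)))
size-step (keep {a = a} {d = d} s) rewrite sum-later s | size-step s =
  +-suc (a + Vec.sum d) (size d)

size-∅ : ∀ m → size (∅ {m}) ≡ 0
size-∅ zero = refl
size-∅ (suc m) =
  trans (cong (Vec.sum (∅ {m}) +_) (size-∅ m)) (trans (+-identityʳ _) (sum-∅ m))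
  where
  sum-∅ : ∀ m → Vec.sum (∅ {m}) ≡ 0
  sum-∅ zero = refl
  sum-∅ (suc m) = sum-∅ m

size≡0⇒∅ : (μ : Shape m) → size μ ≡ 0 → μ ≡ ∅
size≡0⇒∅ []      _  = refl
size≡0⇒∅ (a ∷ d) eq = cong₂ _∷_ (m+n≡0⇒m≡0 a (m+n≡0⇒m≡0 (a + Vec.sum d) eq))
                                (size≡0⇒∅ d (m+n≡0⇒n≡0 (a + Vec.sum d) eq))

size-walk : {κ : Shape m} → Walk i κ → size κ ≡ i
size-walk {m = m} []    = size-∅ m
size-walk ((_ , u) ∷ Q) = trans (size-step u) (cong suc (size-walk Q))

size-chain : {κ : Shape m} → Chain n κ → size κ ≤ n
size-chain {m = m} nil     = ≤-reflexive (size-∅ m)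
size-chain (skip C)        = m≤n⇒m≤1+n (size-chain C)
size-chain (add C (_ , u)) = subst (_≤ _) (sym (size-step u)) (s≤s (size-chain C))

walk→chain : {κ : Shape m} → Walk n κ → Chain n κ
walk→chain []      = nil
walk→chain (u ∷ Q) = add (walk→chain Q) u

chain→walk : {κ : Shape m} → Chain n κ → size κ ≡ n → Walk n κ
chain→walk nil       eq = []
chain→walk (skip C)  eq = contradiction (size-chain C) (<⇒≱ (≤-reflexive (sym eq)))
chain→walk (add C u) eq =
  u ∷ chain→walk C (suc-injective (trans (sym (size-step (proj₂ u))) eq))

walk→chain→walk : {κ : Shape m} (Q : Walk n κ) (eq : size κ ≡ n) →
                  chain→walk (walk→chain Q) eq ≡ Q
walk→chain→walk []      eq = refl
walk→chain→walk (u ∷ Q) eq = cong (u ∷_) (walk→chain→walk Q _)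

chain→walk→chain : {κ : Shape m} (C : Chain n κ) (eq : size κ ≡ n) →
                   walk→chain (chain→walk C eq) ≡ C
chain→walk→chain nil       eq = refl
chain→walk→chain (skip C)  eq = contradiction (size-chain C) (<⇒≱ (≤-reflexive (sym eq)))
chain→walk→chain (add C u) eq = cong (λ C → add C u) (chain→walk→chain C _)

Pair↔walks : Pair m n n ↔ ∃ λ (κ : Shape m) → Walk n κ × Walk n κ
Pair↔walks = mk↔ₛ′
  (λ (κ , C , Q) → κ , chain→walk C (size-walk Q) , Q)
  (λ (κ , P , Q) → κ , walk→chain P , Q)
  (λ (κ , P , Q) → cong (λ P → κ , P , Q) (walk→chain→walk P _))
  (λ (κ , C , Q) → cong (λ C → κ , C , Q) (chain→walk→chain C _))

-- Counting closed walks

∃-cong : {X Y : A → Set} → (∀ a → X a ↔ Y a) → ∃ X ↔ ∃ Y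
∃-cong X↔Y = Σ.congˡ {k = bijection} (λ {a} → X↔Y a)

step? : (r : Fin m) (d : Shape m) → Dec (∃ (Step r d))
step? zero    (a ∷ d) = yes (_ , front)
step? (suc zero) (zero ∷ d) = no λ ()
step? (suc zero) (suc a ∷ b ∷ d) = yes (_ , hop front)
step? (suc (suc r)) (a ∷ d) =
  map′ (λ (_ , s) → _ , keep s) (λ { (_ , keep s) → _ , s }) (step? (suc r) d)

unstep? : (r : Fin m) (e : Shape m) → Dec (∃ λ d → Step r d e)
unstep? zero    (zero ∷ e) = no λ ()
unstep? zero    (suc a ∷ e) = yes (_ , front)
unstep? (suc zero) (a ∷ zero ∷ e) = no λ { (_ , hop ()) }
unstep? (suc zero) (a ∷ suc b ∷ e) = yes (_ , hop front)
unstep? (suc (suc r)) (a ∷ e) =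
  map′ (λ (_ , s) → _ , keep s) (λ { (_ , keep s) → _ , s }) (unstep? (suc r) e)

-- The sum of g over Fin m.
sumFin : ∀ m → (Fin m → ℕ) → ℕ
sumFin zero    g = 0
sumFin (suc m) g = g zero + sumFin m (g ∘ suc)

sumFin↔∃ : ∀ m {g : Fin m → ℕ} {X : Fin m → Set} → (∀ r → Fin (g r) ↔ X r) → Fin (sumFin m g) ↔ ∃ X
sumFin↔∃ zero    g↔X = mk↔ₛ′ (λ ()) (λ ()) (λ ()) (λ ())
sumFin↔∃ (suc m) {X = X} g↔X = ↔-trans Fin.+↔⊎ (↔-trans (g↔X zero ⊎-↔ sumFin↔∃ m (g↔X ∘ suc)) split)
  where
  split : (X zero ⊎ ∃ (X ∘ suc)) ↔ ∃ X
  split = mk↔ₛ′ (λ { (inj₁ x) → zero , x ; (inj₂ (r , x)) → suc r , x })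
                (λ { (zero , x) → inj₁ x ; (suc r , x) → inj₂ (r , x) })
                (λ { (zero , x) → refl ; (suc r , x) → refl })
                (λ { (inj₁ x) → refl ; (inj₂ (r , x)) → refl })

-- For a property P with at most one solution a: the value g a if there is a solution, and 0
-- otherwise.
count : {P : A → Set} → Dec (∃ P) → (A → ℕ) → ℕ
count (yes (a , _)) g = g a
count (no _)        g = 0

count↔ : {P X : A → Set} (P? : Dec (∃ P)) → ((p q : ∃ P) → p ≡ q) → {g : A → ℕ} →
         (∀ a → P a → Fin (g a) ↔ X a) → Fin (count P? g) ↔ ∃ λ a → P a × X a
count↔ {X = X} (yes (a , p)) unique g↔X = ↔-trans (g↔X a p) (mk↔ₛ′
  (λ x → a , p , x) (λ (b , q , x) → subst (X ∘ proj₁) (unique (b , q) (a , p)) x)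
  (λ (b , q , x) → lemma x)
  (λ x → cong (λ eq → subst (X ∘ proj₁) eq x) (uip (unique (a , p) (a , p)) refl)))
  where
  lemma : ∀ {b q} (x : X b) → (a , p , subst (X ∘ proj₁) (unique (b , q) (a , p)) x) ≡ (b , q , x)
  lemma {b} {q} x with refl ← unique (b , q) (a , p) = refl
count↔ (no ¬p) _ _ = mk↔ₛ′ (λ ()) (λ (a , p , _) → contradiction (a , p) ¬p)
  (λ (a , p , _) → contradiction (a , p) ¬p) (λ ())

-- downs t d counts the ways to remove t boxes from d one by one; ups n t d counts those to add t
-- boxes to d and to remove n boxes afterwards.
downs : ℕ → Shape m → ℕ
downs         zero    d = 1
downs {m = m} (suc t) d = sumFin m λ r → count (unstep? r d) (downs t)

ups : ℕ → ℕ → Shape m → ℕ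
ups         n zero    d = downs n d
ups {m = m} n (suc t) d = sumFin m λ r → count (step? r d) (ups n t)

downs↔ : ∀ i {κ : Shape m} → size κ ≡ i → Fin (downs i κ) ↔ Walk i κ
downs↔ zero {κ} eq with refl ← size≡0⇒∅ κ eq = mk↔ₛ′
  (λ _ → []) (λ _ → zero) (λ Q → nil-unique Q refl) (λ { zero → refl })
  where
  nil-unique : ∀ {κ : Shape m} (Q : Walk 0 κ) (eq : κ ≡ ∅) → [] ≡ subst (Walk 0) eq Q
  nil-unique [] refl = refl
downs↔ {m = m} (suc i) {κ} eq = ↔-trans
  (sumFin↔∃ m λ r → count↔ (unstep? r κ) step-source-unique λ ν u →
    downs↔ i (suc-injective (trans (sym (size-step u)) eq)))
  unfold
  where
  unfold : (∃₂ λ r ν → Step r ν κ × Walk i ν) ↔ Walk (suc i) κ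
  unfold = mk↔ₛ′ to (λ { ((r , u) ∷ Q) → r , _ , u , Q }) (λ { (u ∷ Q) → refl }) (λ _ → refl)
    where
    to : (∃₂ λ r ν → Step r ν κ × Walk i ν) → Walk (suc i) κ
    to (r , ν , u , Q) = (r , u) ∷ Q

-- What can follow a walk into κ: t further box additions, and an independent walk of length n
-- into the shape reached.
Ext : ℕ → ℕ → Shape m → Set
Ext n zero    κ = Walk n κ
Ext n (suc t) κ = ∃₂ λ r κ′ → Step r κ κ′ × Ext n t κ′

ups↔ : ∀ n t {κ : Shape m} → size κ + t ≡ n → Fin (ups n t κ) ↔ Ext n t κ
ups↔ n zero    eq = downs↔ n (trans (sym (+-identityʳ _)) eq)
ups↔ {m = m} n (suc t) {κ} eq = sumFin↔∃ m λ r → count↔ (step? r κ) step-target-unique λ κ′ u →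
  ups↔ n t (trans (cong (_+ t) (size-step u)) (trans (sym (+-suc (size κ) t)) eq))

-- A closed walk at ∅, cut at κ after i steps.
Loop : ∀ m → ℕ → ℕ → ℕ → Set
Loop m n i t = ∃ λ (κ : Shape m) → Walk i κ × Ext n t κ

shift-loop : Loop m n i (suc t) ↔ Loop m n (suc i) t
shift-loop {m} {n} {i} {t} = mk↔ₛ′ to
  (λ { (κ′ , (r , u) ∷ P , E) → _ , P , r , κ′ , u , E })
  (λ { (κ′ , (r , u) ∷ P , E) → refl })
  (λ _ → refl)
  where
  to : Loop m n i (suc t) → Loop m n (suc i) t
  to (κ , P , r , κ′ , u , E) = κ′ , (r , u) ∷ P , E

loop↔ : ∀ n t i → Loop m n i t ↔ Loop m n (t + i) 0
loop↔         n zero    i = ↔-refl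
loop↔ {m = m} n (suc t) i = ↔-trans shift-loop
  (subst (λ z → Loop m n (suc i) t ↔ Loop m n z 0) (+-suc t i) (loop↔ n t (suc i)))

ups↔walks : ∀ m n → Fin (ups n n (∅ {m})) ↔ ∃ λ (κ : Shape m) → Walk n κ × Walk n κ
ups↔walks m n = ↔-trans (ups↔ n n (cong (_+ n) (size-∅ m))) (↔-trans start
  (subst (λ z → Loop m n 0 n ↔ Loop m n z 0) (+-identityʳ n) (loop↔ n n 0)))
  where
  to : Ext n n ∅ → Loop m n 0 n
  to E = ∅ , [] , E
  start : Ext n n ∅ ↔ Loop m n 0 n
  start = mk↔ₛ′ to (λ { (_ , [] , E) → E }) (λ { (_ , [] , E) → refl }) (λ _ → refl)

#Av↔ups : ∀ m n → Fin (#Av n (increasing (suc m))) ↔ Fin (ups n n (∅ {m}))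
#Av↔ups m n = ↔-trans (#Av↔Pair m n) (↔-trans Pair↔walks (↔-sym (ups↔walks m n)))

-- Computation trees

module ComputationTree (M : NTM) (x : List Bool) where
  open NTM M
  open Computation M x
  open Config

  -- Tree S c v: all computation paths from c are finite and stay within space S, and v of them
  -- accept. Trees S c as v: the same for the paths that begin with one of the actions as. Accepting
  -- states occur only at the leaves.
  data Tree (S : ℕ) (c : Config) : ℕ → Set
  data Trees (S : ℕ) (c : Config) : List (Action Q Γ workTapes) → ℕ → Set

  data Tree S c where
    accept : enabled c ≡ [] → T (accepting (state c)) → space c ≤ S → Tree S c 1
    node   : ∀ {v} → ¬ T (accepting (state c)) → space c ≤ S → Trees S c (enabled c) v → Tree S c v

  data Trees S c where
    []  : Trees S c [] 0
    _∷_ : ∀ {a as v w} → Tree S (perform a c) v → Trees S c as w → Trees S c (a ∷ as) (v + w)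

  trees : ∀ {S c} n (f : Fin n → Action Q Γ workTapes) {v : Fin n → ℕ} →
          (∀ r → Tree S (perform (f r) c) (v r)) → Trees S c (tabulate f) (sumFin n v)
  trees zero    f t = []
  trees (suc n) f t = t zero ∷ trees n (f ∘ suc) (t ∘ suc)

  AcceptingFrom : Config → Set
  AcceptingFrom c = ∃ λ c′ → c ⟶* c′ × Accepts c′

  private variable
    S v : ℕ
    c : Config
    as : List (Action Q Γ workTapes)

  tree-space : Tree S c v → ∀ c′ → c ⟶* c′ → space c′ ≤ S
  trees-space : ∀ {a} → Trees S c as v → a ∈ᴸ as → ∀ c′ → perform a c ⟶* c′ → space c′ ≤ S
  tree-space (accept _ _ s) c′ ε = s
  tree-space (accept halt _ _) c′ (step a∈ ◅ _) with () ← subst (_ ∈ᴸ_) halt a∈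
  tree-space (node _ s ts) c′ ε = s
  tree-space (node _ s ts) c′ (step a∈ ◅ p) = trees-space ts a∈ c′ p
  trees-space (t ∷ ts) (here refl) = tree-space t
  trees-space (t ∷ ts) (there a∈)  = trees-space ts a∈

  tree-acc : Tree S c v → Acc (flip _⟶_) c
  trees-acc : ∀ {a} → Trees S c as v → a ∈ᴸ as → Acc (flip _⟶_) (perform a c)
  tree-acc (accept halt _ _) = acc λ { (step a∈) → contradiction (subst (_ ∈ᴸ_) halt a∈) λ () }
  tree-acc (node _ _ ts) = acc λ { (step a∈) → trees-acc ts a∈ }
  trees-acc (t ∷ ts) (here refl) = tree-acc t
  trees-acc (t ∷ ts) (there a∈)  = trees-acc ts a∈

  -- The accepting paths from c that begin with one of the actions as.
  StepInto : Config → List (Action Q Γ workTapes) → Set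
  StepInto c as = ∃ λ a → a ∈ᴸ as × AcceptingFrom (perform a c)

  accept↔ : enabled c ≡ [] → T (accepting (state c)) → Fin 1 ↔ AcceptingFrom c
  accept↔ {c} halt ok = mk↔ₛ′ (λ _ → c , ε , halt , ok) (λ _ → zero) unique (λ { zero → refl })
    where
    unique : (p : AcceptingFrom c) → (c , ε , halt , ok) ≡ p
    unique (_ , ε , halt′ , ok′) =
      cong₂ (λ h y → c , ε , h , y) (uip halt halt′) (Bool.T-irrelevant ok ok′)
    unique (_ , step a∈ ◅ _ , _) = contradiction (subst (_ ∈ᴸ_) halt a∈) λ ()

  step↔ : ¬ T (accepting (state c)) → StepInto c (enabled c) ↔ AcceptingFrom c
  step↔ {c} rej = mk↔ₛ′
    (λ (a , a∈ , c′ , p , ok) → c′ , step a∈ ◅ p , ok)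
    from
    (λ { (_ , ε , _ , ok) → contradiction ok rej ; (c′ , step a∈ ◅ p , ok) → refl })
    (λ _ → refl)
    where
    from : AcceptingFrom c → StepInto c (enabled c)
    from (_  , ε , _ , ok)         = contradiction ok rej
    from (c′ , step a∈ ◅ p , ok)   = _ , a∈ , c′ , p , ok

  here-there : ∀ {a as} → (AcceptingFrom (perform a c) ⊎ StepInto c as) ↔ StepInto c (a ∷ as)
  here-there {c} {a} {as} = mk↔ₛ′ to from
    (λ { (_ , here refl , p) → refl ; (_ , there a∈ , p) → refl })
    (λ { (inj₁ p) → refl ; (inj₂ p) → refl })
    where
    to : (AcceptingFrom (perform a c) ⊎ StepInto c as) → StepInto c (a ∷ as)
    to (inj₁ p)            = a , here refl , p
    to (inj₂ (b , b∈ , p)) = b , there b∈ , p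
    from : StepInto c (a ∷ as) → AcceptingFrom (perform a c) ⊎ StepInto c as
    from (_ , here refl , p) = inj₁ p
    from (_ , there a∈ , p)  = inj₂ (_ , a∈ , p)

  tree↔ : Tree S c v → Fin v ↔ AcceptingFrom c
  trees↔ : Trees S c as v → Fin v ↔ StepInto c as
  tree↔ (accept halt ok _) = accept↔ halt ok
  tree↔ (node rej _ ts)     = ↔-trans (trees↔ ts) (step↔ rej)
  trees↔ []       = mk↔ₛ′ (λ ()) (λ { (_ , () , _) }) (λ { (_ , () , _) }) (λ ())
  trees↔ {c = c} (t ∷ ts) = ↔-trans Fin.+↔⊎ (↔-trans (tree↔ t ⊎-↔ trees↔ ts) (here-there {c}))

-- Finite sets

Finite : Set → Set
Finite A = ∃ λ s → A ↔ Fin s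

Bool-finite : Finite Bool
Bool-finite = 2 , ↔-sym Fin.2↔Bool

×-finite : Finite A → Finite B → Finite (A × B)
×-finite (s , f) (t , g) = s * t , ↔-trans (f ×-↔ g) (↔-sym Fin.*↔×)

Maybe-finite : Finite A → Finite (Maybe A)
Maybe-finite {A} (s , f) = suc s , mk↔ₛ′ enc dec
  (λ { zero → refl ; (suc i) → cong suc (Inverse.strictlyInverseˡ f i) })
  (λ { nothing → refl ; (just a) → cong just (Inverse.strictlyInverseʳ f a) })
  where
  enc : Maybe A → Fin (suc s)
  enc nothing  = zero
  enc (just a) = suc (Inverse.to f a)
  dec : Fin (suc s) → Maybe A
  dec zero    = nothing
  dec (suc i) = just (Inverse.from f i)

Vec-finite : Finite A → ∀ m → Finite (Vec A m)
Vec-finite     fin zero    = 1 , mk↔ₛ′ (λ _ → zero) (λ _ → []) (λ { zero → refl }) (λ { [] → refl })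
Vec-finite {A} fin (suc m) with s , f ← ×-finite fin (Vec-finite fin m) =
  s , ↔-trans (mk↔ₛ′ Vec.uncons (λ (a , v) → a ∷ v) (λ _ → refl) (λ { (_ ∷ _) → refl })) f

-- Counters in binary

-- What a sweep still has to do to a counter: nothing, add one, or subtract one.
data Carry : Set where
  idle inc dec : Carry

Carry-finite : Finite Carry
Carry-finite = 3 , mk↔ₛ′
  (λ { idle → zero ; inc → suc zero ; dec → suc (suc zero) })
  (λ { zero → idle ; (suc zero) → inc ; (suc (suc zero)) → dec })
  (λ { zero → refl ; (suc zero) → refl ; (suc (suc zero)) → refl })
  (λ { idle → refl ; inc → refl ; dec → refl })

-- Delta c v w: the operation c takes the counter value v to w. Subtracting one from 0 is undefined.
data Delta : Carry → ℕ → ℕ → Set where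
  idle : ∀ {v} → Delta idle v v
  inc  : ∀ {v} → Delta inc v (suc v)
  dec  : ∀ {v} → Delta dec (suc v) v

-- out c b and next c b: the bit written and the operation passed on when c meets the bit b.
out : Carry → Bool → Bool
out idle b     = b
out inc  false = true
out inc  true  = false
out dec  false = true
out dec  true  = false

next : Carry → Bool → Carry
next idle b     = idle
next inc  false = idle
next inc  true  = inc
next dec  false = dec
next dec  true  = idle

double : ℕ → ℕ
double zero    = zero
double (suc v) = suc (suc (double v))

-- The number with least significant bit b and remaining bits v.
place : Bool → ℕ → ℕ
place false v = double v
place true  v = suc (double v)

-- The operation c on a number amounts to writing a bit and performing the next operation on the
-- remaining bits.
delta-place⁻ : ∀ c b {v v′} → Delta c (place b v) v′ →
               ∃ λ w → Delta (next c b) v w × v′ ≡ place (out c b) w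
delta-place⁻ idle b     idle = _ , idle , refl
delta-place⁻ inc  false inc  = _ , idle , refl
delta-place⁻ inc  true  inc  = _ , inc , refl
delta-place⁻ dec  false {suc v} dec = _ , dec , refl
delta-place⁻ dec  true  dec  = _ , idle , refl

delta-place⁺ : ∀ c b {v w} → Delta (next c b) v w → Delta c (place b v) (place (out c b) w)
delta-place⁺ idle b     idle = idle
delta-place⁺ inc  false idle = inc
delta-place⁺ inc  true  inc  = inc
delta-place⁺ dec  false dec  = dec
delta-place⁺ dec  true  idle = dec

-- Delta in all m counters at once.
data Deltas : Vec Carry m → Shape m → Shape m → Set where
  []  : Deltas [] [] []
  _∷_ : ∀ {c v w} {cs : Vec Carry m} {d e : Shape m} →
        Delta c v w → Deltas cs d e → Deltas (c ∷ cs) (v ∷ d) (w ∷ e)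

-- A work tape symbol holds one bit of each of the m counters.
Digit : ℕ → Set
Digit = Vec Bool

-- The counters stored in a word, least significant bits first.
val : List (Digit m) → Shape m
val []      = ∅
val (g ∷ u) = zipWith place g (val u)

deltas-place⁻ : ∀ (cs : Vec Carry m) g {d e} → Deltas cs (zipWith place g d) e →
  ∃ λ e′ → Deltas (zipWith next cs g) d e′ × e ≡ zipWith place (zipWith out cs g) e′
deltas-place⁻ []       []      {[]}    []       = [] , [] , refl
deltas-place⁻ (c ∷ cs) (b ∷ g) {_ ∷ _} (δ ∷ δs)
  with w , δ′ , refl ← delta-place⁻ c b δ with e′ , δs′ , refl ← deltas-place⁻ cs g δs =
  w ∷ e′ , δ′ ∷ δs′ , refl

deltas-place⁺ : ∀ (cs : Vec Carry m) g {d e} → Deltas (zipWith next cs g) d e →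
  Deltas cs (zipWith place g d) (zipWith place (zipWith out cs g) e)
deltas-place⁺ []       []      []       = []
deltas-place⁺ (c ∷ cs) (b ∷ g) (δ ∷ δs) = delta-place⁺ c b δ ∷ deltas-place⁺ cs g δs

isInc isDec : Carry → Bool
isInc inc = true
isInc _   = false
isDec dec = true
isDec _   = false

any : (Carry → Bool) → Vec Carry m → Bool
any p = Vec.foldr _ (λ c b → p c ∨ b) false

-- At the end of the word the remaining value is ∅: a pending subtraction is undefined, and the
-- pending additions are carried out by one more digit.
deltas-∅⁻ : ∀ (cs : Vec Carry m) {e} → Deltas cs ∅ e →
            any isDec cs ≡ false × e ≡ val (Vec.map isInc cs ∷ [])
deltas-∅⁻ []          []          = refl , refl
deltas-∅⁻ (idle ∷ cs) (idle ∷ δs) with p , q ← deltas-∅⁻ cs δs = p , cong (_ ∷_) q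
deltas-∅⁻ (inc  ∷ cs) (inc ∷ δs)  with p , q ← deltas-∅⁻ cs δs = p , cong (_ ∷_) q

deltas-∅⁺ : ∀ (cs : Vec Carry m) → any isDec cs ≡ false → ∃ (Deltas cs ∅)
deltas-∅⁺ []          _  = _ , []
deltas-∅⁺ (idle ∷ cs) eq = _ , idle ∷ proj₂ (deltas-∅⁺ cs eq)
deltas-∅⁺ (inc  ∷ cs) eq = _ , inc ∷ proj₂ (deltas-∅⁺ cs eq)

no-inc : ∀ (cs : Vec Carry m) → any isInc cs ≡ false → val (Vec.map isInc cs ∷ []) ≡ ∅
no-inc []          _  = refl
no-inc (idle ∷ cs) eq = cong (0 ∷_) (no-inc cs eq)
no-inc (dec  ∷ cs) eq = cong (0 ∷_) (no-inc cs eq)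

some-inc : ∀ (cs : Vec Carry m) → any isInc cs ≡ true → 1 ≤ Vec.sum (val (Vec.map isInc cs ∷ []))
some-inc (idle ∷ cs) eq = some-inc cs eq
some-inc (inc  ∷ cs) eq = s≤s z≤n
some-inc (dec  ∷ cs) eq = some-inc cs eq

sum-place : ∀ (g : Digit m) d → 2 * Vec.sum d ≤ Vec.sum (zipWith place g d)
sum-place []      []      = z≤n
sum-place (b ∷ g) (v ∷ d) =
  ≤-trans (≤-reflexive (*-distribˡ-+ 2 v (Vec.sum d))) (+-mono-≤ (place≥ b v) (sum-place g d))
  where
  double≡ : ∀ v → 2 * v ≡ double v
  double≡ zero    = refl
  double≡ (suc v) = trans (*-suc 2 v) (cong (2 +_) (double≡ v))
  place≥ : ∀ b v → 2 * v ≤ place b v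
  place≥ false v = ≤-reflexive (double≡ v)
  place≥ true  v = m≤n⇒m≤1+n (≤-reflexive (double≡ v))

-- Box additions as operations on counters

-- The Boolean φ is the direction of the walk: true while boxes are added, false while they are
-- removed.
gain loss : Bool → Carry
gain true  = inc
gain false = dec
loss true  = dec
loss false = inc

-- The operations on the counters for adding or removing a box in row r.
change : Bool → Fin m → Vec Carry m
change φ zero          = gain φ ∷ replicate _ idle
change φ (suc zero)    = loss φ ∷ change φ zero
change φ (suc (suc r)) = idle ∷ change φ (suc r)

change-injective : ∀ φ {r s : Fin m} → change φ r ≡ change φ s → r ≡ s
change-injective φ     {zero}        {zero}        eq = refl
change-injective true  {zero}        {suc zero}    ()
change-injective false {zero}        {suc zero}    ()
change-injective true  {zero}        {suc (suc s)} ()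
change-injective false {zero}        {suc (suc s)} ()
change-injective true  {suc zero}    {zero}        ()
change-injective false {suc zero}    {zero}        ()
change-injective φ     {suc zero}    {suc zero}    eq = refl
change-injective true  {suc zero}    {suc (suc s)} ()
change-injective false {suc zero}    {suc (suc s)} ()
change-injective true  {suc (suc r)} {zero}        ()
change-injective false {suc (suc r)} {zero}        ()
change-injective true  {suc (suc r)} {suc zero}    ()
change-injective false {suc (suc r)} {suc zero}    ()
change-injective φ     {suc (suc r)} {suc (suc s)} eq =
  cong suc (change-injective φ (cong Vec.tail eq))

idle⁺ : (d : Shape m) → Deltas (replicate m idle) d d
idle⁺ []      = []
idle⁺ (_ ∷ d) = idle ∷ idle⁺ d

idle⁻ : ∀ {d e : Shape m} → Deltas (replicate m idle) d e → d ≡ e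
idle⁻ []          = refl
idle⁻ (idle ∷ δs) = cong (_ ∷_) (idle⁻ δs)

DirectedStep : Bool → Fin m → Shape m → Shape m → Set
DirectedStep true  r d e = Step r d e
DirectedStep false r d e = Step r e d

change⁺ : ∀ φ {r : Fin m} {d e} → DirectedStep φ r d e → Deltas (change φ r) d e
change⁺ true  front    = inc ∷ idle⁺ _
change⁺ true  (hop s)  = dec ∷ change⁺ true s
change⁺ true  (keep s) = idle ∷ change⁺ true s
change⁺ false front    = dec ∷ idle⁺ _
change⁺ false (hop s)  = inc ∷ change⁺ false s
change⁺ false (keep s) = idle ∷ change⁺ false s

change⁻ : ∀ φ (r : Fin m) {d e} → Deltas (change φ r) d e → DirectedStep φ r d e
change⁻ true  zero          (inc ∷ δs)  with refl ← idle⁻ δs = front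
change⁻ true  (suc zero)    (dec ∷ δs)  = hop (change⁻ true zero δs)
change⁻ true  (suc (suc r)) (idle ∷ δs) = keep (change⁻ true (suc r) δs)
change⁻ false zero          (dec ∷ δs)  with refl ← idle⁻ δs = front
change⁻ false (suc zero)    (inc ∷ δs)  = hop (change⁻ false zero δs)
change⁻ false (suc (suc r)) (idle ∷ δs) = keep (change⁻ false (suc r) δs)

-- The machine

-- The states: done accepts; rest φ is the state between two sweeps, in which the head also returns
-- to the left end of the word; sweep φ cs performs the operations cs on the cells from the head on.
State : ℕ → Set
State m = Maybe (Bool × Maybe (Vec Carry m))

pattern done       = nothing
pattern rest φ     = just (φ , nothing)
pattern sweep φ cs = just (φ , just cs)

-- Work tape cells. The word of digits stands to the right of the starting cell, which stays blank
-- and marks the left end.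
Cell : ℕ → Set
Cell m = Maybe (Digit m)

Act : ℕ → Set
Act m = Action (State m) (Cell m) 1

act : State m → Move → Cell m × Move → Act m
act q d w = action q d (w ∷ [])

choose : Bool → Move → Fin m → Act m
choose φ d r = act (sweep φ (change φ r)) d (nothing , right)

-- The cell written at the right end of the word: one more digit if some carry is pending.
leaveCell : Vec Carry m → Cell m
leaveCell cs = if any isInc cs then just (Vec.map isInc cs) else nothing

-- The choices of the machine are the rows r. While boxes are added, the input head moves to the
-- right, over ones only; at the right end marker the direction is reversed, and at the left end
-- marker the machine accepts.
δ : State m → InputSymbol → Vec (Cell m) 1 → List (Act m)
δ done         _           _              = []
δ (rest φ)     _           (just g ∷ [])  = act (rest φ) stay (just g , left) ∷ []
δ (rest true)  ⊢           (nothing ∷ []) = act (rest true) right (nothing , stay) ∷ []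
δ (rest true)  (bit true)  (nothing ∷ []) = tabulate (choose true right)
δ (rest true)  (bit false) (nothing ∷ []) = []
δ (rest true)  ⊣           (nothing ∷ []) = act (rest false) left (nothing , stay) ∷ []
δ (rest false) (bit _)     (nothing ∷ []) = tabulate (choose false left)
δ (rest false) ⊢           (nothing ∷ []) = act done stay (nothing , stay) ∷ []
δ (rest false) ⊣           (nothing ∷ []) = []
δ (sweep φ cs) _           (just g ∷ [])  =
  act (sweep φ (zipWith next cs g)) stay (just (zipWith out cs g) , right) ∷ []
δ (sweep φ cs) _           (nothing ∷ []) =
  if any isDec cs then [] else act (rest φ) stay (leaveCell cs , left) ∷ []

choose-injective : ∀ φ d {r s : Fin m} → choose φ d r ≡ choose φ d s → r ≡ s
choose-injective φ d eq = change-injective φ (sweep-injective (cong Action.nextState eq))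
  where
  sweep-injective : ∀ {φ} {cs ds : Vec Carry m} → sweep φ cs ≡ sweep φ ds → cs ≡ ds
  sweep-injective refl = refl

single! : {a : A} → Uniqueᴸ (a ∷ [])
single! = Listᴬ.[] ∷ []

δ-unique : ∀ (q : State m) a bs → Uniqueᴸ (δ q a bs)
δ-unique done         _           _              = []
δ-unique (rest true)  _           (just g ∷ [])  = single!
δ-unique (rest false) _           (just g ∷ [])  = single!
δ-unique (rest true)  ⊢           (nothing ∷ []) = single!
δ-unique (rest true)  (bit true)  (nothing ∷ []) = tabulate⁺ (choose-injective true right)
δ-unique (rest true)  (bit false) (nothing ∷ []) = []
δ-unique (rest true)  ⊣           (nothing ∷ []) = single!
δ-unique (rest false) (bit _)     (nothing ∷ []) = tabulate⁺ (choose-injective false left)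
δ-unique (rest false) ⊢           (nothing ∷ []) = single!
δ-unique (rest false) ⊣           (nothing ∷ []) = []
δ-unique (sweep φ cs) _           (just g ∷ [])  = single!
δ-unique (sweep φ cs) _           (nothing ∷ []) with any isDec cs
... | true  = []
... | false = single!

isDone : State m → Bool
isDone done     = true
isDone (just _) = false

machine : ℕ → NTM
machine m = record
  { workTapes = 1
  ; Q         = State m
  ; Γ         = Cell m
  ; Q-finite  = Maybe-finite (×-finite Bool-finite (Maybe-finite (Vec-finite Carry-finite m)))
  ; Γ-finite  = Maybe-finite (Vec-finite Bool-finite m)
  ; start     = rest true
  ; accepting = isDone
  ; blank     = nothing
  ; δ         = δ
  ; δ-unique  = δ-unique
  }

-- The computation tree of the machine

-- The input symbol in position 1 + i.
at : List Bool → ℕ → InputSymbol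
at []      _       = ⊣
at (b ∷ y) zero    = bit b
at (b ∷ y) (suc i) = at y i

-- In the last clause both sides compute to those for y: the symbol read does not depend on b.
readInput-at : (x : List Bool) (p : Fin (1 + length x)) → readInput x (suc p) ≡ at x (toℕ p)
readInput-at []      p       = refl
readInput-at (b ∷ y) zero    = refl
readInput-at (b ∷ y) (suc p) = readInput-at y p

at-bit : ∀ x {i} → i < length x → ∃ λ b → at x i ≡ bit b
at-bit (b ∷ x) {zero}  lt = b , refl
at-bit (b ∷ x) {suc i} lt = at-bit x (s≤s⁻¹ lt)

toℕ-right : (p : Fin (suc n)) → toℕ p < n → toℕ (moveHead right p) ≡ suc (toℕ p)
toℕ-right {suc n} zero    lt = refl
toℕ-right {suc n} (suc p) lt = cong suc (toℕ-right p (s≤s⁻¹ lt))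

sum≤size : (d : Shape m) → Vec.sum d ≤ size d
sum≤size []      = z≤n
sum≤size (a ∷ d) = m≤m+n _ _

module Run (m : ℕ) (x : List Bool) where
  open Computation (machine m) x
  open ComputationTree (machine m) x
  open Config

  -- The space bound: between two sweeps the word has at most 1 + l digits, and a sweep needs at most
  -- four more cells.
  l S : ℕ
  l = ⌊log₂ length x ⌋
  S = 5 + l

  Head : Set
  Head = Fin (2 + length x)

  private variable
    φ : Bool
    h : Head
    v : ℕ
    c : Config
    p u : List (Digit m)
    tl : List (Cell m)

  -- The configuration with work tape T.
  at-work : State m → Head → Tape (Cell m) → Config
  at-work q h T = config q h (T ∷ [])

  -- The cells to the left of the head after passing the digits p, the last one first.
  behind : List (Digit m) → List (Cell m)
  behind p = List.map just p ++ nothing ∷ []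

  -- The cells beyond the right end of the word: at most one of them has been visited.
  data Margin : List (Cell m) → Set where
    fresh   : Margin []
    visited : Margin (nothing ∷ [])

  -- The cells holding the word u, and the margin.
  ahead : List (Digit m) → List (Cell m) → List (Cell m)
  ahead u tl = List.map just u ++ tl

  -- The head stands just left of the word u, on the last of the digits p already passed, or on the
  -- blank at the left end if there are none.
  before-word : List (Digit m) → List (Digit m) → List (Cell m) → Tape (Cell m)
  before-word []      u tl = tape [] nothing (ahead u tl)
  before-word (g ∷ p) u tl = tape (behind p) (just g) (ahead u tl)

  -- The head stands on the first cell of the word u.
  at-word : List (Cell m) → List (Digit m) → List (Cell m) → Tape (Cell m)
  at-word ls []      tl = tape ls nothing []
  at-word ls (g ∷ u) tl = tape ls (just g) (ahead u tl)

  -- The configuration before a sweep: the head is at the left end.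
  home : Bool → Head → List (Digit m) → List (Cell m) → Config
  home φ h u tl = at-work (rest φ) h (before-word [] u tl)

  length-behind : ∀ p → length (behind p) ≡ length p + 1
  length-behind p = trans (List.length-++ (List.map just p)) (cong (_+ 1) (List.length-map just p))

  length-ahead : ∀ u → Margin tl → length (ahead u tl) ≤ length u + 1
  length-ahead {tl} u mg = ≤-trans
    (≤-reflexive (trans (List.length-++ (List.map just u))
                        (cong (_+ length tl) (List.length-map just u))))
    (+-monoʳ-≤ (length u) (short mg))
    where
    short : Margin tl → length tl ≤ 1
    short fresh   = z≤n
    short visited = ≤-refl

  visited-≤ : ∀ q h ls s rs {a b} → length ls ≤ a → length rs ≤ b → a + b + 1 ≤ S →
              space (at-work q h (tape ls s rs)) ≤ S
  visited-≤ q h ls s rs {a} {b} la lb le = begin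
    length ls + 1 + length rs + 0  ≡⟨ +-identityʳ _ ⟩
    length ls + 1 + length rs      ≤⟨ +-mono-≤ (+-monoˡ-≤ 1 la) lb ⟩
    a + 1 + b                      ≡⟨ +-assoc a 1 b ⟩
    a + (1 + b)                    ≡⟨ cong (a +_) (+-comm 1 b) ⟩
    a + (b + 1)                    ≡⟨ +-assoc a b 1 ⟨
    a + b + 1                      ≤⟨ le ⟩
    S                              ∎
    where open ≤-Reasoning

  -- The digits p and u leave b cells within the space bound. Three cells are needed for the two
  -- blanks at the ends and the digit under the head, a fourth one for the digit that may be added.
  Fits : ℕ → List (Digit m) → List (Digit m) → Set
  Fits b p u = b + (length p + length u) ≤ S

  fits-shift : ∀ b p g g′ u → Fits b p (g ∷ u) → Fits b (g′ ∷ p) u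
  fits-shift b p g g′ u = subst (λ z → b + z ≤ S) (+-suc (length p) (length u))

  fits-unshift : ∀ b p g u → Fits b (g ∷ p) u → Fits b p (g ∷ u)
  fits-unshift b p g u = subst (λ z → b + z ≤ S) (sym (+-suc (length p) (length u)))

  fits-tail : ∀ p g u → Fits 4 p (g ∷ u) → Fits 3 p u
  fits-tail p g u = ≤-trans (+-mono-≤ (n≤1+n 3) (+-monoʳ-≤ (length p) (n≤1+n (length u))))

  fits-space : ∀ p u q h s → Fits 3 p u → Margin tl →
               space (at-work q h (tape (behind p) s (ahead u tl))) ≤ S
  fits-space {tl} p u q h s fits mg = visited-≤ q h (behind p) s (ahead u tl)
    (≤-reflexive (length-behind p)) (length-ahead u mg)
    (subst (_≤ S) (arith (length p) (length u)) fits)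
    where
    arith : ∀ a b → 3 + (a + b) ≡ (a + 1) + (b + 1) + 1
    arith a b = begin
      3 + (a + b)             ≡⟨ cong (2 +_) (+-comm 1 (a + b)) ⟩
      2 + (a + b + 1)         ≡⟨ cong suc (+-comm 1 (a + b + 1)) ⟩
      suc (a + b + 1 + 1)     ≡⟨ cong (λ z → suc (z + 1)) (+-assoc a b 1) ⟩
      suc (a + (b + 1)) + 1   ≡⟨ cong (_+ 1) (+-suc a (b + 1)) ⟨
      a + (1 + (b + 1)) + 1   ≡⟨ cong (_+ 1) (+-assoc a 1 (b + 1)) ⟨
      (a + 1) + (b + 1) + 1   ∎
      where open ≡-Reasoning

  det : ∀ {a} → ¬ T (isDone (state c)) → space c ≤ S → enabled c ≡ a ∷ [] →
        Tree S (perform a c) v → Tree S c v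
  det {c} {v} rej sp eq t = subst (Tree S c) (+-identityʳ v)
    (node rej sp (subst (λ as → Trees S c as (v + 0)) (sym eq) (t ∷ [])))

  reject : ¬ T (isDone (state c)) → space c ≤ S → enabled c ≡ [] → Tree S c 0
  reject {c} rej sp eq = node rej sp (subst (λ as → Trees S c as 0) (sym eq) [])

  choice : ∀ f {v : Fin m → ℕ} →
           ¬ T (isDone (state c)) → space c ≤ S → enabled c ≡ tabulate f →
           (∀ r → Tree S (perform (f r) c) (v r)) → Tree S c (sumFin m v)
  choice {c} f {v} rej sp eq ts =
    node rej sp (subst (λ as → Trees S c as (sumFin m v)) (sym eq) (trees m f ts))

  move-left : ∀ p g s u tl → writeMove nothing (g , left) (tape (behind p) s (ahead u tl)) ≡
              (before-word p [] (g ∷ ahead u tl))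
  move-left []      g s u tl = refl
  move-left (_ ∷ p) g s u tl = refl

  move-right : ∀ ls s c u → Margin tl →
               writeMove nothing (s , right) (tape ls c (ahead u tl)) ≡ at-word (s ∷ ls) u tl
  move-right ls s c []      fresh   = refl
  move-right ls s c []      visited = refl
  move-right ls s c (g ∷ u) mg      = refl

  before-word-∷ : ∀ p g u tl → before-word p [] (just g ∷ ahead u tl) ≡ before-word p (g ∷ u) tl
  before-word-∷ []      g u tl = refl
  before-word-∷ (_ ∷ p) g u tl = refl

  -- In state rest φ the head runs back to the left end.
  return : ∀ p u → Fits 3 p u → Margin tl → Tree S (home φ h (p ʳ++ u) tl) v →
           Tree S (at-work (rest φ) h (before-word p u tl)) v
  return []      u fits mg t = t
  return {tl} {φ} {h} {v} (g ∷ p) u fits mg t =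
    det (λ ()) (fits-space p u (rest φ) h (just g) (≤-trans (n≤1+n _) fits) mg) refl
      (subst (λ T → Tree S (at-work (rest φ) h T) v)
        (sym (trans (move-left p (just g) (just g) u tl) (before-word-∷ p g u tl)))
        (return p (g ∷ u) (fits-unshift 3 p g u fits) mg t))

  -- A sweep lengthens the word by at most one digit, and only if a counter of the result needs it.
  Grown : List (Digit m) → List (Digit m) → Shape m → Set
  Grown u u′ e = length u′ ≡ length u ⊎ (length u′ ≡ suc (length u) × 2 ^ length u ≤ Vec.sum e)

  grown-∷ : ∀ g g′ u u′ e → Grown u u′ e → Grown (g ∷ u) (g′ ∷ u′) (zipWith place g′ e)
  grown-∷ g g′ u u′ e (inj₁ eq)        = inj₁ (cong suc eq)
  grown-∷ g g′ u u′ e (inj₂ (eq , le)) =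
    inj₂ (cong suc eq , ≤-trans (*-monoʳ-≤ 2 le) (sum-place g′ e))

  -- Whenever the sweep over u, which follows the digits p already written, ends by storing e, there
  -- are v accepting paths from the configuration in which the head is back.
  ReturnsWith : Bool → Head → List (Digit m) → List (Digit m) → Shape m → ℕ → Set
  ReturnsWith φ h p u e v = ∀ u′ {tl} → Margin tl → val u′ ≡ e → Grown u u′ e →
                            Tree S (home φ h (p ʳ++ u′) tl) v

  -- The end of a sweep: the right end of the word has been reached, and cs is pending.
  finish : ∀ p cs e → Deltas cs ∅ e → Fits 4 p [] → ReturnsWith φ h p [] e v →
           Tree S (at-work (rest φ) h (before-word p [] (leaveCell cs ∷ []))) v
  finish {φ} {h} {v} p cs e δs fits k with any isInc cs in eq
  ... | true  = subst (λ T → Tree S (at-work (rest φ) h T) v)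
                  (sym (before-word-∷ p (Vec.map isInc cs) [] []))
                  (return p (Vec.map isInc cs ∷ [])
                    (subst (_≤ S) (cong (3 +_) (sym (+-suc (length p) 0))) fits) fresh
                    (k (Vec.map isInc cs ∷ []) fresh (sym e≡)
                       (inj₂ (refl , subst (λ e → 1 ≤ Vec.sum e) (sym e≡) (some-inc cs eq)))))
    where
    e≡ : e ≡ val (Vec.map isInc cs ∷ [])
    e≡ = proj₂ (deltas-∅⁻ cs δs)
  ... | false = return p [] (≤-trans (n≤1+n _) fits) visited
                  (k [] visited (sym (trans (proj₂ (deltas-∅⁻ cs δs)) (no-inc cs eq))) (inj₁ refl))

  sweep-defined : ∀ p u cs e → Deltas cs (val u) e → Fits 4 p u → Margin tl →
                  ReturnsWith φ h p u e v →
                  Tree S (at-work (sweep φ cs) h (at-word (behind p) u tl)) v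
  sweep-defined {tl} {φ} {h} {v} p [] cs e δs fits mg k =
    det (λ ()) (fits-space p [] (sweep φ cs) h nothing (≤-trans (n≤1+n _) fits) fresh)
      (cong (λ b → if b then [] else act (rest φ) stay (leaveCell cs , left) ∷ [])
            (proj₁ (deltas-∅⁻ cs δs)))
      (subst (λ T → Tree S (at-work (rest φ) h T) v)
        (sym (move-left p (leaveCell cs) nothing [] []))
        (finish p cs e δs fits k))
  sweep-defined {tl} {φ} {h} {v} p (g ∷ u) cs e δs fits mg k
    with e′ , δs′ , refl ← deltas-place⁻ cs g δs =
    det (λ ()) (fits-space p u (sweep φ cs) h (just g) (fits-tail p g u fits) mg) refl
      (subst (λ T → Tree S (at-work (sweep φ (zipWith next cs g)) h T) v)
        (sym (move-right (behind p) (just g′) (just g) u mg))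
        (sweep-defined (g′ ∷ p) u (zipWith next cs g) e′ δs′ (fits-shift 4 p g g′ u fits) mg
          λ u′ mg′ eq gr → k (g′ ∷ u′) mg′ (cong (zipWith place g′) eq) (grown-∷ g g′ u u′ e′ gr)))
    where g′ = zipWith out cs g

  sweep-undefined : ∀ p u cs → ¬ ∃ (Deltas cs (val u)) → Fits 4 p u → Margin tl →
                    Tree S (at-work (sweep φ cs) h (at-word (behind p) u tl)) 0
  sweep-undefined {tl} {φ} {h} p [] cs ¬δ fits mg with any isDec cs in eq
  ... | true  =
      reject (λ ()) (fits-space p [] (sweep φ cs) h nothing (≤-trans (n≤1+n _) fits) fresh)
      (cong (λ b → if b then [] else act (rest φ) stay (leaveCell cs , left) ∷ []) eq)
  ... | false = contradiction (deltas-∅⁺ cs eq) ¬δ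
  sweep-undefined {tl} {φ} {h} p (g ∷ u) cs ¬δ fits mg =
    det (λ ()) (fits-space p u (sweep φ cs) h (just g) (fits-tail p g u fits) mg) refl
      (subst (λ T → Tree S (at-work (sweep φ (zipWith next cs g)) h T) 0)
        (sym (move-right (behind p) (just g′) (just g) u mg))
        (sweep-undefined (g′ ∷ p) u (zipWith next cs g)
          (λ (e , δs) → ¬δ (_ , deltas-place⁺ cs g δs)) (fits-shift 4 p g g′ u fits) mg))
    where g′ = zipWith out cs g

  -- The sweep that follows the choice of row r contributes f e accepting paths if the box can be
  -- added or removed with result e, and none otherwise.
  operate : ∀ φ h r u (e? : Dec (∃ (DirectedStep φ r (val u)))) {f : Shape m → ℕ} →
            Fits 4 [] u → Margin tl →
            (∀ e → DirectedStep φ r (val u) e → ReturnsWith φ h [] u e (f e)) →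
            Tree S (at-work (sweep φ (change φ r)) h
                     (writeMove nothing (nothing , right) (before-word [] u tl))) (count e? f)
  operate {tl} φ h r u e? {f} fits mg k =
    subst (λ T → Tree S (at-work (sweep φ (change φ r)) h T) (count e? f))
      (sym (move-right [] nothing nothing u mg)) (go e?)
    where
    go : ∀ e? → Tree S (at-work (sweep φ (change φ r)) h (at-word (behind []) u tl)) (count e? f)
    go (yes (e , s)) = sweep-defined [] u (change φ r) e (change⁺ φ s) fits mg (k e s)
    go (no ¬s)       =
      sweep-undefined [] u (change φ r) (λ (e , δs) → ¬s (e , change⁻ φ r δs)) fits mg

  -- The bound on the length of the word between two sweeps.
  Short : List (Digit m) → Set
  Short u = length u ≤ suc l

  short⇒fits : ∀ u → Short u → Fits 4 [] u
  short⇒fits u = +-monoʳ-≤ 4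

  -- A digit of weight 2 ^ L is only appended if the top row has at least 2 ^ L boxes; the number of
  -- boxes does not exceed the length of the input.
  short-grown : ∀ u u′ e → Short u → Grown u u′ e → size e ≤ length x → Short u′
  short-grown u u′ e su (inj₁ eq)        _  = subst (_≤ suc l) (sym eq) su
  short-grown u u′ e su (inj₂ (eq , le)) le′ = subst (_≤ suc l) (sym eq) (s≤s (begin
    length u                 ≡⟨ ⌊log₂[2^n]⌋≡n (length u) ⟨
    ⌊log₂ 2 ^ length u ⌋     ≤⟨ ⌊log₂⌋-mono-≤ (≤-trans le (≤-trans (sum≤size e) le′)) ⟩
    l                        ∎))
    where open ≤-Reasoning

  home-space : ∀ φ h u → Short u → Margin tl → space (home φ h u tl) ≤ S
  home-space {tl} φ h u su mg =
    visited-≤ (rest φ) h [] nothing (ahead u tl) {0} z≤n (length-ahead u mg)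
    (≤-trans (≤-reflexive (trans (+-comm (length u + 1) 1) (cong suc (+-comm (length u) 1))))
      (≤-trans (s≤s (s≤s su)) (+-monoˡ-≤ l {3} (s≤s (s≤s (s≤s z≤n))))))

  scan : ∀ p {a} → at x (toℕ p) ≡ a → readInput x (suc p) ≡ a
  scan p eq = trans (readInput-at x p) eq

  -- The second half of the computation: t boxes are left to be removed.
  descend : ∀ t h u → toℕ h ≡ t → t ≤ length x → size (val u) ≤ t → Short u → Margin tl →
            Tree S (home false h u tl) (downs t (val u))
  descend {tl} zero zero u eq le sz su mg =
    det (λ ()) (home-space false zero u su mg) refl
      (accept refl _ (home-space false zero u su mg))
  descend {tl} (suc t) (suc p) u eq le sz su mg with b , eqb ← at-bit x le =
    choice (choose false left) (λ ()) (home-space false (suc p) u su mg)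
      (cong (λ s → δ (rest false) s (nothing ∷ []))
        (scan p (trans (cong (at x) (suc-injective eq)) eqb)))
      λ r → operate false (inject₁ p) r u (unstep? r (val u)) (short⇒fits u su) mg
        λ { e s u′ mg′ refl gr →
          let sz′ = s≤s⁻¹ (subst (_≤ suc t) (size-step s) sz) in
          descend t (inject₁ p) u′ (trans (Fin.toℕ-inject₁ p) (suc-injective eq))
            (≤-trans (n≤1+n t) le) sz′
            (short-grown u u′ e su gr (≤-trans sz′ (≤-trans (n≤1+n t) le))) mg′ }

  -- The number of accepting paths when the given shape has been built and y is the unread part of
  -- the input.
  value : List Bool → Shape m → ℕ
  value []          d = downs (length x) d
  value (true ∷ y)  d = sumFin m λ r → count (step? r d) (value y)
  value (false ∷ y) d = 0

  -- The first half of the computation: i boxes have been added, and y is the unread part of the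
  -- input x.
  ascend : ∀ y i p u → toℕ p ≡ i → (∀ j → at x (i + j) ≡ at y j) → i + length y ≡ length x →
           size (val u) ≤ i → Short u → Margin tl →
           Tree S (home true (suc p) u tl) (value y (val u))
  ascend {tl} [] i p u eq suffix len sz su mg =
    det (λ ()) (home-space true (suc p) u su mg)
      (cong (λ s → δ (rest true) s (nothing ∷ [])) (scan p end))
      (descend (length x) (inject₁ p) u (trans (Fin.toℕ-inject₁ p) (trans eq i≡)) ≤-refl
        (subst (size (val u) ≤_) i≡ sz) su mg)
    where
    i≡ : i ≡ length x
    i≡ = trans (sym (+-identityʳ i)) len
    end : at x (toℕ p) ≡ ⊣
    end = trans (cong (at x) (trans eq (sym (+-identityʳ i)))) (suffix 0)
  ascend {tl} (false ∷ y) i p u eq suffix len sz su mg =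
    reject (λ ()) (home-space true (suc p) u su mg)
      (cong (λ s → δ (rest true) s (nothing ∷ []))
        (scan p (trans (cong (at x) (trans eq (sym (+-identityʳ i)))) (suffix 0))))
  ascend {tl} (true ∷ y) i p u eq suffix len sz su mg =
    choice (choose true right) (λ ()) (home-space true (suc p) u su mg)
      (cong (λ s → δ (rest true) s (nothing ∷ []))
        (scan p (trans (cong (at x) (trans eq (sym (+-identityʳ i)))) (suffix 0))))
      λ r → operate true (suc (moveHead right p)) r u (step? r (val u)) (short⇒fits u su) mg
        λ { e s u′ mg′ refl gr →
          let sz′ = subst (_≤ suc i) (sym (size-step s)) (s≤s sz) in
          ascend y (suc i) (moveHead right p) u′
            (trans (toℕ-right p (subst (_< length x) (sym eq) i<n)) (cong suc eq))
            (λ j → trans (cong (at x) (sym (+-suc i j))) (suffix (suc j)))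
            (trans (sym (+-suc i (length y))) len)
            sz′ (short-grown u u′ e su gr (≤-trans sz′ i<n)) mg′ }
    where
    i<n : i < length x
    i<n = subst (i <_) len
      (subst (suc i ≤_) (sym (+-suc i (length y))) (s≤s (m≤m+n i (length y))))

  computation : Tree S initial (value x ∅)
  computation =
    det (λ ()) (home-space true zero [] z≤n fresh) refl
      (ascend x 0 zero [] refl (λ _ → refl) refl (≤-reflexive (size-∅ m)) z≤n fresh)

  value-ones : ∀ t d → value (List.replicate t true) d ≡ ups (length x) t d
  value-ones zero    d = refl
  value-ones (suc t) d = sumFin-cong m (λ r → count-cong (step? r d) (value-ones t))
    where
    sumFin-cong : ∀ n {f g : Fin n → ℕ} → (∀ r → f r ≡ g r) → sumFin n f ≡ sumFin n g
    sumFin-cong zero    _  = refl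
    sumFin-cong (suc n) eq = cong₂ _+_ (eq zero) (sumFin-cong n (eq ∘ suc))
    count-cong : ∀ {P : Shape m → Set} (P? : Dec (∃ P)) {f g : Shape m → ℕ} →
                 (∀ d → f d ≡ g d) → count P? f ≡ count P? g
    count-cong (yes (d , _)) eq = eq d
    count-cong (no _)        eq = refl

  value-other : ∀ y d → y ≢ ones (length y) → value y d ≡ 0
  value-other []          d y≢ = contradiction refl y≢
  value-other (false ∷ y) d y≢ = refl
  value-other (true ∷ y)  d y≢ = sumFin-zero m (λ r → count-zero (step? r d))
    where
    y′≢ : y ≢ ones (length y)
    y′≢ = y≢ ∘ cong (true ∷_)
    sumFin-zero : ∀ n {f : Fin n → ℕ} → (∀ r → f r ≡ 0) → sumFin n f ≡ 0
    sumFin-zero zero    _  = refl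
    sumFin-zero (suc n) eq = cong₂ _+_ (eq zero) (sumFin-zero n (eq ∘ suc))
    count-zero : ∀ {P : Shape m → Set} (P? : Dec (∃ P)) → count P? (value y) ≡ 0
    count-zero (yes (e , _)) = value-other y e y′≢
    count-zero (no _)        = refl

  onOnes↔ : Fin (onOnes (λ n → #Av n (increasing (suc m))) x) ↔ Fin (value x ∅)
  onOnes↔ = by-cases (List.≡-dec Bool._≟_ x (ones (length x)))
    where
    by-cases : (ones? : Dec (x ≡ ones (length x))) →
               Fin (if does ones? then #Av (length x) (increasing (suc m)) else 0) ↔ Fin (value x ∅)
    by-cases (yes eq) = subst (λ v → Fin (#Av (length x) (increasing (suc m))) ↔ Fin v)
      (trans (sym (value-ones (length x) ∅)) (cong (λ y → value y ∅) (sym eq)))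
      (#Av↔ups m (length x))
    by-cases (no x≢)  = subst (λ v → Fin 0 ↔ Fin v) (sym (value-other x ∅ x≢)) ↔-refl

-- Membership in #L

theorem3p28 : (k : ℕ) .{{_ : NonZero k}} → onOnes (λ n → #Av n (increasing k)) ∈ #L
theorem3p28 (suc m) =
  machine m ,
  (λ x → ComputationTree.tree-acc (machine m) x (Run.computation m x)) ,
  -- 5 + l ≤ 6 l for l = ⌊log₂ length x ⌋, since l ≥ 1 for inputs of length at least 2.
  (6 , 2 , λ x 2≤n c p → ≤-trans
    (ComputationTree.tree-space (machine m) x (Run.computation m x) c p)
    (≤-trans (+-monoˡ-≤ _ (*-monoʳ-≤ 5 (⌊log₂⌋-mono-≤ 2≤n)))
             (≤-reflexive (+-comm (5 * ⌊log₂ length x ⌋) _)))) ,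
  (λ x → ↔-trans (Run.onOnes↔ m x)
                 (ComputationTree.tree↔ (machine m) x (Run.computation m x)))
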